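{- Let $n\geq 3$ and let the edges of the complete graph $K_n$ on $n$ vertices be coloured with three colours. Then there exist a colour $c$ and a set $A$ of $3$ vertices such that $A$ strongly $c$-dominates at least $2n/3$ vertices, i.e. there are at least $2n/3$ vertices $b$ for which some $a\in A$ has the edge $ab$ coloured $c$.
   Context: Given an edge-colouring of a complete graph, a colour $c$ and vertex sets $A,B$, we say $A$ strongly $c$-dominates $B$ if for every $b\in B$ there is $a\in A$ such that the edge $ab$ has colour $c$ (in particular $b\neq a$). "$A$ strongly $c$-dominates $m$ vertices" means the set of vertices strongly $c$-dominated by $A$ has size at least $m$. -}

module Defs where

open import Data.Nat using (ℕ)
open import Data.Fin using (Fin; _≟_)
open import Data.Fin.Properties using (any?)
open import Data.Fin.Subset using (Subset; _∈_)
open import Data.Fin.Subset.Properties using (_∈?_)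
open import Data.Vec using (tabulate)
open import Data.Product using (∃-syntax; _×_)
open import Relation.Binary.PropositionalEquality using (_≡_)
open import Relation.Nullary using (¬_; Dec)
open import Relation.Nullary.Decidable using (⌊_⌋; _×-dec_; ¬?)

-- An edge-colouring of the complete graph K_n (vertex set Fin n) with k colours:
-- a symmetric function on pairs of vertices (diagonal values are irrelevant,
-- since strong domination requires a ≠ b).
record EdgeColouring (n k : ℕ) : Set where
  field
    colour : Fin n → Fin n → Fin k
    sym    : ∀ x y → colour x y ≡ colour y x
open EdgeColouring public

StronglyDominated : ∀ {n k} → EdgeColouring n k → Fin k → Subset n → Fin n → Set
StronglyDominated χ c A b = ∃[ a ] (a ∈ A × ¬ (a ≡ b) × colour χ a b ≡ c)

stronglyDominated? : ∀ {n k} (χ : EdgeColouring n k) (c : Fin k) (A : Subset n) (b : Fin n)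
                   → Dec (StronglyDominated χ c A b)
stronglyDominated? χ c A b =
  any? (λ a → (a ∈? A) ×-dec (¬? (a ≟ b) ×-dec (colour χ a b ≟ c)))

strongDom : ∀ {n k} → EdgeColouring n k → Fin k → Subset n → Subset n
strongDom χ c A = tabulate λ b → ⌊ stronglyDominated? χ c A b ⌋

{-# OPTIONS --safe #-}
module Submission where

-- Suppose that no three vertices dominate 2n/3 vertices in one colour. Then for all vertices a, b, c
-- and every colour i, the sum over x of 3 [x is not i-dominated by a, b, c] - 1 is positive, and so is
-- any nonnegative combination of such sums over a, b, c and further vertices, weighted by the colour
-- pattern of these vertices. The weights are chosen so that the total is nevertheless nonpositive: after
-- averaging over all orderings of the vertices it is nonpositive on every pattern, a finite check. All
-- vertices range over the whole vertex set independently, so patterns with coinciding vertices occur too.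
--
-- The first certificate, found by linear programming, lives on patterns of six vertices and has positive
-- weight on rainbow triangles, which are therefore absent. Without rainbow triangles, four vertices and
-- the weight [ab and ac, but not bc, have colour i] suffice.

open import Defs
open import Data.Nat.Properties as ℕ hiding (_≟_)
open import Algebra.Properties.Semiring.Sum +-*-semiring using (sum; sum-cong-≗; ∑-distrib-+; ∑-comm; *-distribˡ-sum)
open import Data.Bool using (Bool; T; true; false; not; _∧_; _∨_; if_then_else_)
open import Data.Empty using (⊥; ⊥-elim)
open import Data.Fin using (Fin; zero; suc; _≟_)
open import Data.Fin.Patterns using (0F; 1F; 2F)
open import Data.Fin.Properties using (any?)
open import Data.Fin.Subset using (Subset; ∣_∣; inside; outside; _⊆_; _∈_; _∪_; ⁅_⁆; ⊤)
open import Data.Fin.Subset.Properties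
  using (anySubset?; ⊆⊤; ∣⊤∣≡n; s⊆s; x∈⁅x⁆; ∣⁅x⁆∣≡1; p⊆p∪q; q⊆p∪q)
open import Data.List using (List; []; _∷_; _∷ʳ_; length; map)
open import Data.List.Relation.Binary.Permutation.Propositional as ↭ using (_↭_; prep; swap; ↭-sym)
open import Data.List.Relation.Binary.Permutation.Propositional.Properties using (↭-length; map⁺; ++⁺ʳ)
open import Data.Maybe using (Maybe; just; nothing; is-just)
open import Data.Nat using (ℕ; zero; suc; _+_; _*_; _≤_; _<_; _≤ᵇ_; _≤?_; _!; z≤n; s≤s; NonZero)
open import Data.Nat.DivMod using (_/_; _%_; /-monoˡ-≤; m*n/n≡m; m%n≤m; [m+kn]%n≡m%n)
open import Data.Nat.Tactic.RingSolver using (solve-∀)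
open import Data.Product using (∃-syntax; _×_; _,_; proj₁; proj₂)
open import Data.Unit using (tt)
open import Data.Vec using ([]; _∷_; tabulate)
open import Function using (_∘_)
open import Relation.Binary.PropositionalEquality as ≡
  using (_≡_; _≢_; refl; cong; cong₂; subst; subst₂; module ≡-Reasoning)
open import Relation.Nullary using (¬_; yes; no; contradiction)
open import Relation.Nullary.Decidable using (⌊_⌋; _×-dec_)

-- Vertices range independently because averaging over orderings is then an exact identity between
-- totals (`tupleSum-permSum`). The coincidences that this admits also supply the contradictions: a
-- rainbow triangle a, b, c yields the five-tuple a, b, c, b, b, and an edge uv yields u, v, v, both
-- of positive weight. Strictness of the assumption survives as an integer surplus: n < 3m means n +
-- 1 ≤ 3m, so the weight of each tuple is left over once more and has to vanish.
--
-- The first certificate is rooted at a rainbow triangle because the edges of such a triangle single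
-- out the three colours. Hence multipliers are needed only up to renaming of colours, and only for
-- some ordering of each five-vertex pattern. The obstacle is the size of the check, since a
-- six-vertex pattern consists of fifteen hues: only patterns extending a clause of the table are
-- examined, inconsistent ones are cut off early, and orderings matching no clause are abandoned.

private variable
  A B : Set
  n : ℕ

-- Sums over tuples and over reorderings of a list

sum-mono-≤ : {f g : Fin n → ℕ} → (∀ i → f i ≤ g i) → sum f ≤ sum g
sum-mono-≤ {zero}  le = z≤n
sum-mono-≤ {suc n} le = +-mono-≤ (le zero) (sum-mono-≤ (le ∘ suc))

term≤sum : (f : Fin n → ℕ) (i : Fin n) → f i ≤ sum f
term≤sum f zero    = m≤m+n _ _
term≤sum f (suc i) = ≤-trans (term≤sum (f ∘ suc) i) (m≤n+m _ _)

sum-const : ∀ n c → sum {n} (λ _ → c) ≡ n * c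
sum-const zero    c = refl
sum-const (suc n) c = cong (c +_) (sum-const n c)

tupleSum : (k : ℕ) → (List (Fin n) → ℕ) → ℕ
tupleSum zero    f = f []
tupleSum (suc k) f = sum λ x → tupleSum k λ xs → f (x ∷ xs)

module _ {n : ℕ} where

  private variable
    f g : List (Fin n) → ℕ

  tupleSum-+ : ∀ k (f g : List (Fin n) → ℕ) → tupleSum k (λ xs → f xs + g xs) ≡ tupleSum k f + tupleSum k g
  tupleSum-+ zero    f g = refl
  tupleSum-+ (suc k) f g = ≡.trans
    (sum-cong-≗ λ x → tupleSum-+ k (λ xs → f (x ∷ xs)) (λ xs → g (x ∷ xs)))
    (∑-distrib-+ (λ x → tupleSum k λ xs → f (x ∷ xs)) (λ x → tupleSum k λ xs → g (x ∷ xs)))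

  tupleSum-* : ∀ k c (f : List (Fin n) → ℕ) → tupleSum k (λ xs → c * f xs) ≡ c * tupleSum k f
  tupleSum-* zero    c f = refl
  tupleSum-* (suc k) c f = ≡.trans
    (sum-cong-≗ λ x → tupleSum-* k c (λ xs → f (x ∷ xs)))
    (≡.sym (*-distribˡ-sum c λ x → tupleSum k λ xs → f (x ∷ xs)))

  tupleSum-mono-≤ : ∀ k → (∀ xs → length xs ≡ k → f xs ≤ g xs) → tupleSum k f ≤ tupleSum k g
  tupleSum-mono-≤ zero    le = le [] refl
  tupleSum-mono-≤ (suc k) le = sum-mono-≤ λ x → tupleSum-mono-≤ k λ xs eq → le (x ∷ xs) (cong suc eq)

  term≤tupleSum : (f : List (Fin n) → ℕ) → ∀ xs → f xs ≤ tupleSum (length xs) f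
  term≤tupleSum f []       = ≤-refl
  term≤tupleSum f (x ∷ xs) = ≤-trans (term≤tupleSum (λ ys → f (x ∷ ys)) xs)
    (term≤sum (λ y → tupleSum (length xs) λ ys → f (y ∷ ys)) x)

  tupleSum-∷ʳ : (f : List (Fin n) → ℕ) → ∀ k → tupleSum (suc k) f ≡ tupleSum k λ xs → sum λ x → f (xs ∷ʳ x)
  tupleSum-∷ʳ f zero    = refl
  tupleSum-∷ʳ f (suc k) = sum-cong-≗ λ x → tupleSum-∷ʳ (λ xs → f (x ∷ xs)) k

selectSum : (A → List A → ℕ) → List A → ℕ
selectSum h []       = 0
selectSum h (x ∷ xs) = h x xs + selectSum (λ y ys → h y (x ∷ ys)) xs

-- Orderings are built by choosing one element at a time, so that an evaluation can stop after a
-- prefix known to contribute nothing; `charge-sum` exploits this.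
permSum : ℕ → (List A → ℕ) → List A → ℕ
permSum zero    f xs = f []
permSum (suc k) f xs = selectSum (λ x ys → permSum k (λ zs → f (x ∷ zs)) ys) xs

selectSum-cong : {h k : A → List A → ℕ} → (∀ x ys → h x ys ≡ k x ys) → ∀ xs → selectSum h xs ≡ selectSum k xs
selectSum-cong eq []       = refl
selectSum-cong eq (x ∷ xs) = cong₂ _+_ (eq x xs) (selectSum-cong (λ y ys → eq y (x ∷ ys)) xs)

permSum-cong : ∀ k {f g : List A → ℕ} → (∀ xs → f xs ≡ g xs) → ∀ xs → permSum k f xs ≡ permSum k g xs
permSum-cong zero    eq xs = eq []
permSum-cong (suc k) eq xs = selectSum-cong (λ x → permSum-cong k λ zs → eq (x ∷ zs)) xs

selectSum-zero : (xs : List A) → selectSum (λ _ _ → 0) xs ≡ 0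
selectSum-zero []       = refl
selectSum-zero (x ∷ xs) = selectSum-zero xs

permSum-zero : ∀ k (xs : List A) → permSum k (λ _ → 0) xs ≡ 0
permSum-zero zero    xs = refl
permSum-zero (suc k) xs = ≡.trans (selectSum-cong (λ _ → permSum-zero k) xs) (selectSum-zero xs)

linear-shuffle : ∀ c a b a′ b′ → (c * a + b) + (c * a′ + b′) ≡ c * (a + a′) + (b + b′)
linear-shuffle = solve-∀

selectSum-linear : ∀ c (h k : A → List A → ℕ) xs →
  selectSum (λ x ys → c * h x ys + k x ys) xs ≡ c * selectSum h xs + selectSum k xs
selectSum-linear c h k []       = ≡.sym (≡.trans (+-identityʳ _) (*-zeroʳ c))
selectSum-linear c h k (x ∷ xs) = ≡.trans
  (cong (c * h x xs + k x xs +_) (selectSum-linear c (λ y ys → h y (x ∷ ys)) (λ y ys → k y (x ∷ ys)) xs))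
  (linear-shuffle c (h x xs) (k x xs) _ _)

permSum-linear : ∀ k c (f g : List A → ℕ) xs →
  permSum k (λ ys → c * f ys + g ys) xs ≡ c * permSum k f xs + permSum k g xs
permSum-linear zero    c f g xs = refl
permSum-linear (suc k) c f g xs = ≡.trans
  (selectSum-cong (λ x → permSum-linear k c (λ zs → f (x ∷ zs)) (λ zs → g (x ∷ zs))) xs)
  (selectSum-linear c (λ x → permSum k λ zs → f (x ∷ zs)) (λ x → permSum k λ zs → g (x ∷ zs)) xs)

-- Reordering the list also reorders the remainder handed to `h`, hence the hypothesis. In the swap
-- case the first two choices trade places, and every later choice sees them in the opposite order.
selectSum-↭ : {h : A → List A → ℕ} → (∀ x {ys zs} → ys ↭ zs → h x ys ≡ h x zs) →
  ∀ {xs ys} → xs ↭ ys → selectSum h xs ≡ selectSum h ys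
selectSum-↭ resp ↭.refl           = refl
selectSum-↭ resp (prep x p)       = cong₂ _+_ (resp x p) (selectSum-↭ (λ y q → resp y (prep x q)) p)
selectSum-↭ resp (↭.trans p q)    = ≡.trans (selectSum-↭ resp p) (selectSum-↭ resp q)
selectSum-↭ {h = h} resp (swap {xs} {ys} x y p) = begin
  h x (y ∷ xs) + (h y (x ∷ xs) + rest x y xs)
    ≡⟨ cong₂ _+_ (resp x (prep y p)) (cong₂ _+_ (resp y (prep x p))
         (≡.trans (selectSum-cong (λ z zs → resp z (swap x y ↭.refl)) xs)
                  (selectSum-↭ (λ z q → resp z (prep y (prep x q))) p))) ⟩
  h x (y ∷ ys) + (h y (x ∷ ys) + rest y x ys)
    ≡⟨ exchange (h x (y ∷ ys)) (h y (x ∷ ys)) _ ⟩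
  h y (x ∷ ys) + (h x (y ∷ ys) + rest y x ys) ∎
  where
  open ≡-Reasoning
  rest = λ u v → selectSum (λ z zs → h z (u ∷ v ∷ zs))
  exchange : ∀ a b c → a + (b + c) ≡ b + (a + c)
  exchange = solve-∀

permSum-↭ : ∀ k (f : List A → ℕ) {xs ys} → xs ↭ ys → permSum k f xs ≡ permSum k f ys
permSum-↭ zero    f p = refl
permSum-↭ (suc k) f p = selectSum-↭ (λ x → permSum-↭ k λ zs → f (x ∷ zs)) p

selectSum-map : (π : A → B) (h : B → List B → ℕ) → ∀ xs →
  selectSum h (map π xs) ≡ selectSum (λ x ys → h (π x) (map π ys)) xs
selectSum-map π h []       = refl
selectSum-map π h (x ∷ xs) = cong (h (π x) (map π xs) +_) (selectSum-map π (λ y ys → h y (π x ∷ ys)) xs)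

permSum-map : ∀ k (π : A → B) (f : List B → ℕ) → ∀ xs → permSum k f (map π xs) ≡ permSum k (f ∘ map π) xs
permSum-map zero    π f xs = refl
permSum-map (suc k) π f xs = ≡.trans (selectSum-map π _ xs)
  (selectSum-cong (λ x → permSum-map k π λ zs → f (π x ∷ zs)) xs)

-- Searching the reorderings of a list

selectAny : (A → List A → Bool) → List A → Bool
selectAny h []       = false
selectAny h (x ∷ xs) = h x xs ∨ selectAny (λ y ys → h y (x ∷ ys)) xs

permAny : ℕ → (List A → Bool) → List A → Bool
permAny zero    f xs = f []
permAny (suc k) f xs = selectAny (λ x ys → permAny k (λ zs → f (x ∷ zs)) ys) xs

selectAny-true : ∀ (h : A → List A → Bool) xs → selectAny h xs ≡ true →
  ∃[ x ] ∃[ ys ] (x ∷ ys ↭ xs × h x ys ≡ true)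
selectAny-true h (x ∷ xs) eq with h x xs in eqₓ
... | true  = x , xs , ↭.refl , eqₓ
... | false with selectAny-true _ xs eq
...   | y , ys , p , eqᵧ = y , x ∷ ys , ↭.trans (swap y x ↭.refl) (prep x p) , eqᵧ

permAny-true : ∀ k (f : List A → Bool) xs → length xs ≡ k → permAny k f xs ≡ true →
  ∃[ ys ] (ys ↭ xs × f ys ≡ true)
permAny-true zero    f []  _   eq = [] , ↭.refl , eq
permAny-true (suc k) f xs len eq with selectAny-true _ xs eq
... | x , ys , p , eqₓ with permAny-true k _ ys (suc-injective (≡.trans (↭-length p) len)) eqₓ
...   | zs , q , eq′ = x ∷ zs , ↭.trans (prep x q) p , eq′

selectAny-false : ∀ (h : A → List A → Bool) {k : A → List A → ℕ} → (∀ x ys → h x ys ≡ false → k x ys ≡ 0) →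
  ∀ xs → selectAny h xs ≡ false → selectSum k xs ≡ 0
selectAny-false h z []       eq = refl
selectAny-false h z (x ∷ xs) eq with h x xs in eqₓ
... | false = cong₂ _+_ (z x xs eqₓ) (selectAny-false _ (λ y ys → z y (x ∷ ys)) xs eq)

-- Disposes of the tuples none of whose orderings begins with a rainbow triangle: they carry no
-- charge.
permAny-false : ∀ k (p : List A → Bool) {f : List A → ℕ} → (∀ xs → p xs ≡ false → f xs ≡ 0) →
  ∀ xs → permAny k p xs ≡ false → permSum k f xs ≡ 0
permAny-false zero    p z xs eq = z [] eq
permAny-false (suc k) p z xs eq = selectAny-false _ (λ x ys → permAny-false k _ (λ zs → z (x ∷ zs)) ys) xs eq

-- Each of the k + 1 positions from which the element can be chosen contributes the same total,
-- because the variables are independent and the order of summation may be exchanged.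
tupleSum-selectSum : ∀ k (h : Fin n → List (Fin n) → ℕ) →
  tupleSum (suc k) (selectSum h) ≡ suc k * sum λ x → tupleSum k (h x)
tupleSum-selectSum zero    h = ≡.trans (sum-cong-≗ λ x → +-identityʳ (h x [])) (≡.sym (*-identityˡ _))
tupleSum-selectSum (suc k) h = begin
  (sum λ x → tupleSum (suc k) λ xs → h x xs + selectSum (λ y ys → h y (x ∷ ys)) xs)
    ≡⟨ (sum-cong-≗ λ x → ≡.trans (tupleSum-+ (suc k) (h x) (selectSum λ y ys → h y (x ∷ ys)))
         (cong (tupleSum (suc k) (h x) +_) (tupleSum-selectSum k λ y ys → h y (x ∷ ys)))) ⟩
  (sum λ x → tupleSum (suc k) (h x) + suc k * (sum λ y → tupleSum k λ ys → h y (x ∷ ys)))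
    ≡⟨ ∑-distrib-+ (λ x → tupleSum (suc k) (h x)) _ ⟩
  S + (sum λ x → suc k * (sum λ y → tupleSum k λ ys → h y (x ∷ ys)))
    ≡⟨ cong (S +_) (≡.sym (*-distribˡ-sum (suc k) λ x → sum λ y → tupleSum k λ ys → h y (x ∷ ys))) ⟩
  S + suc k * (sum λ x → sum λ y → tupleSum k λ ys → h y (x ∷ ys))
    ≡⟨ cong (λ s → S + suc k * s) (∑-comm λ x y → tupleSum k λ ys → h y (x ∷ ys)) ⟩
  S + suc k * S ∎
  where
  open ≡-Reasoning
  S = sum λ x → tupleSum (suc k) (h x)

-- Permuting independent variables with a common range does not change a total. An inequality
-- between totals therefore follows from its symmetrised form on each single tuple.
tupleSum-permSum : ∀ k (f : List (Fin n) → ℕ) → tupleSum k (permSum k f) ≡ k ! * tupleSum k f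
tupleSum-permSum zero    f = ≡.sym (+-identityʳ _)
tupleSum-permSum (suc k) f = begin
  tupleSum (suc k) (permSum (suc k) f)
    ≡⟨ tupleSum-selectSum k (λ x → permSum k λ zs → f (x ∷ zs)) ⟩
  suc k * (sum λ x → tupleSum k (permSum k λ zs → f (x ∷ zs)))
    ≡⟨ cong (suc k *_) (≡.trans (sum-cong-≗ λ x → tupleSum-permSum k λ zs → f (x ∷ zs))
         (≡.sym (*-distribˡ-sum (k !) λ x → tupleSum k λ zs → f (x ∷ zs)))) ⟩
  suc k * (k ! * tupleSum (suc k) f)
    ≡⟨ ≡.sym (*-assoc (suc k) (k !) _) ⟩
  suc k ! * tupleSum (suc k) f ∎
  where open ≡-Reasoning

-- Double counting of 3f - g over all (k+1)-tuples, with g moved across so that no subtraction occurs.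
weights-vanish : ∀ k (f g w : List (Fin n) → ℕ) →
  (∀ xs → length xs ≡ suc k → 3 * permSum (suc k) f xs ≤ permSum (suc k) g xs) →
  (∀ xs → length xs ≡ k → w xs + (sum λ x → g (xs ∷ʳ x)) ≤ 3 * sum λ x → f (xs ∷ʳ x)) →
  ∀ xs → length xs ≡ k → w xs ≡ 0
weights-vanish {n} k f g w sym≤ last≤ xs refl = n≤0⇒n≡0 (≤-trans (term≤tupleSum w xs) W≤0)
  where
  open ≤-Reasoning
  W = tupleSum k w
  F = tupleSum (suc k) f
  G = tupleSum (suc k) g
  3F≤G : 3 * F ≤ G
  3F≤G = *-cancelˡ-≤ (suc k !) {{suc k !≢0}} (begin
    suc k ! * (3 * F)   ≡⟨ *-assoc (suc k !) 3 F ⟨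
    suc k ! * 3 * F     ≡⟨ cong (_* F) (*-comm (suc k !) 3) ⟩
    3 * suc k ! * F     ≡⟨ *-assoc 3 (suc k !) F ⟩
    3 * (suc k ! * F)   ≡⟨ cong (3 *_) (tupleSum-permSum (suc k) f) ⟨
    3 * tupleSum (suc k) (permSum (suc k) f)
                        ≡⟨ tupleSum-* (suc k) 3 (permSum (suc k) f) ⟨
    tupleSum (suc k) (λ ys → 3 * permSum (suc k) f ys)
                        ≤⟨ tupleSum-mono-≤ (suc k) sym≤ ⟩
    tupleSum (suc k) (permSum (suc k) g)
                        ≡⟨ tupleSum-permSum (suc k) g ⟩
    suc k ! * G         ∎)
  W+G≤3F : W + G ≤ 3 * F
  W+G≤3F = begin
    W + G                                                  ≡⟨ cong (W +_) (tupleSum-∷ʳ g k) ⟩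
    W + tupleSum k (λ ys → sum λ x → g (ys ∷ʳ x))          ≡⟨ tupleSum-+ k w (λ ys → sum λ x → g (ys ∷ʳ x)) ⟨
    tupleSum k (λ ys → w ys + (sum λ x → g (ys ∷ʳ x)))     ≤⟨ tupleSum-mono-≤ k last≤ ⟩
    tupleSum k (λ ys → 3 * (sum λ x → f (ys ∷ʳ x)))        ≡⟨ tupleSum-* k 3 (λ ys → sum λ x → f (ys ∷ʳ x)) ⟩
    3 * tupleSum k (λ ys → sum λ x → f (ys ∷ʳ x))          ≡⟨ cong (3 *_) (tupleSum-∷ʳ f k) ⟨
    3 * F                                                  ∎
  W≤0 : W ≤ 0
  W≤0 = +-cancelʳ-≤ G W 0 (≤-trans W+G≤3F 3F≤G)

-- Colour patterns

-- A colour α, β, γ of an edge, or ε for the pair formed by a vertex and itself.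
data Hue : Set where
  α β γ ε : Hue

infix 5 _==_
_==_ : Hue → Hue → Bool
α == α = true
β == β = true
γ == γ = true
ε == ε = true
_ == _ = false

==⇒≡ : ∀ {x y} → (x == y) ≡ true → x ≡ y
==⇒≡ {α} {α} refl = refl
==⇒≡ {β} {β} refl = refl
==⇒≡ {γ} {γ} refl = refl
==⇒≡ {ε} {ε} refl = refl

==-refl : ∀ x → (x == x) ≡ true
==-refl α = refl
==-refl β = refl
==-refl γ = refl
==-refl ε = refl

infixr 4 _⇒_
_⇒_ : Bool → Bool → Bool
true  ⇒ b = b
false ⇒ b = true

⇒-elim : ∀ {b c} → (b ⇒ c) ≡ true → b ≡ true → c ≡ true
⇒-elim eq refl = eq

⇒-intro : ∀ {b c} → (b ≡ true → c ≡ true) → (b ⇒ c) ≡ true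
⇒-intro {true}  f = f refl
⇒-intro {false} f = refl

infixr 6 _∧⁺_
_∧⁺_ : ∀ {b c} → b ≡ true → c ≡ true → (b ∧ c) ≡ true
refl ∧⁺ refl = refl

∧⁻ˡ : ∀ {b c} → (b ∧ c) ≡ true → b ≡ true
∧⁻ˡ {true} _ = refl

∧⁻ʳ : ∀ {b c} → (b ∧ c) ≡ true → c ≡ true
∧⁻ʳ {true} eq = eq

-- If two vertices coincide, then so do their colours v, w towards a third one.
agree : Hue → Hue → Hue → Bool
agree u v w = u == ε ⇒ v == w

iff : Bool → Bool → Bool
iff true  b = b
iff false b = not b

iff⇒≡ : ∀ {b c} → iff b c ≡ true → b ≡ c
iff⇒≡ {true}  {true}  _ = refl
iff⇒≡ {false} {false} _ = refl

-- Opaque so that the checks below are evaluated only where they are proved.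
opaque
  all : (Hue → Bool) → Bool
  all p = p α ∧ p β ∧ p γ ∧ p ε

  all-elim : ∀ {p} → all p ≡ true → ∀ h → p h ≡ true
  all-elim {p} eq α = ∧⁻ˡ eq
  all-elim {p} eq β = ∧⁻ˡ (∧⁻ʳ {p α} eq)
  all-elim {p} eq γ = ∧⁻ˡ (∧⁻ʳ {p β} (∧⁻ʳ {p α} eq))
  all-elim {p} eq ε = ∧⁻ʳ {p γ} (∧⁻ʳ {p β} (∧⁻ʳ {p α} eq))

-- Rainbow triangles and the renaming of colours

rainbow : Hue → Hue → Hue → Bool
rainbow α β γ = true
rainbow α γ β = true
rainbow β α γ = true
rainbow β γ α = true
rainbow γ α β = true
rainbow γ β α = true
rainbow _ _ _ = false

-- The renaming of colours that makes a rainbow triangle (p , q , r) into (α , β , γ).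
rel : Hue → Hue → Hue → Hue → Hue
rel α β _ c = c
rel α γ _ α = α
rel α γ _ β = γ
rel α γ _ γ = β
rel β α _ α = β
rel β α _ β = α
rel β α _ γ = γ
rel β γ _ α = γ
rel β γ _ β = α
rel β γ _ γ = β
rel γ α _ α = β
rel γ α _ β = γ
rel γ α _ γ = α
rel γ β _ α = γ
rel γ β _ β = β
rel γ β _ γ = α
rel _ _ _ _ = ε

hue : Fin 3 → Hue
hue 0F = α
hue 1F = β
hue 2F = γ

unrel : Hue → Hue → Hue → Fin 3 → Hue
unrel p q r 0F = p
unrel p q r 1F = q
unrel p q r 2F = r

opaque
  unfolding all

  rel-injective-check : (all λ p → all λ q → all λ r → rainbow p q r ⇒
    all λ c → all λ d → iff (rel p q r c == rel p q r d) (c == d)) ≡ true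
  rel-injective-check = refl

  rainbow-rel-check : (all λ p → all λ q → all λ r → rainbow p q r ⇒
    all λ u → all λ v → all λ w → iff (rainbow (rel p q r u) (rel p q r v) (rel p q r w)) (rainbow u v w)) ≡ true
  rainbow-rel-check = refl

  -- Renaming relative to a triangle forgets any earlier renaming, since the triangle was renamed
  -- along with everything else. This makes the charge invariant under permutations of the colours
  -- (`charge-rel`).
  rel-rel-check : (all λ p → all λ q → all λ r → rainbow p q r ⇒
    all λ u → all λ v → all λ w → all λ c →
    rel (rel p q r u) (rel p q r v) (rel p q r w) (rel p q r c) == rel u v w c) ≡ true
  rel-rel-check = refl

  rel-root-check : (all λ p → all λ q → all λ r → rainbow p q r ⇒
    (rel p q r p == α) ∧ (rel p q r q == β) ∧ (rel p q r r == γ) ∧ (rel p q r ε == ε)) ≡ true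
  rel-root-check = refl

  rel-hue-check : (all λ p → all λ q → all λ r → rainbow p q r ⇒ all λ c →
    iff (rel p q r c == α) (c == p) ∧ iff (rel p q r c == β) (c == q) ∧ iff (rel p q r c == γ) (c == r)) ≡ true
  rel-hue-check = refl

  rainbow-proper-check : (all λ p → all λ q → all λ r → rainbow p q r ⇒
    not (p == ε) ∧ not (q == ε) ∧ not (r == ε)) ≡ true
  rainbow-proper-check = refl

module Rainbow (p q r : Hue) (rb : rainbow p q r ≡ true) where

  ρ : Hue → Hue
  ρ = rel p q r

  private
    inst : ∀ {f : Hue → Hue → Hue → Bool} → (all λ p → all λ q → all λ r → rainbow p q r ⇒ f p q r) ≡ true →
      f p q r ≡ true
    inst check = ⇒-elim (all-elim (all-elim (all-elim check p) q) r) rb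

  ρ-injective : ∀ c d → (ρ c == ρ d) ≡ (c == d)
  ρ-injective c d = iff⇒≡ (all-elim (all-elim (inst rel-injective-check) c) d)

  rainbow-ρ : ∀ u v w → rainbow (ρ u) (ρ v) (ρ w) ≡ rainbow u v w
  rainbow-ρ u v w = iff⇒≡ (all-elim (all-elim (all-elim (inst rainbow-rel-check) u) v) w)

  rel-ρ : ∀ u v w c → rel (ρ u) (ρ v) (ρ w) (ρ c) ≡ rel u v w c
  rel-ρ u v w c = ==⇒≡ (all-elim (all-elim (all-elim (all-elim (inst rel-rel-check) u) v) w) c)

  ρ-p : ρ p ≡ α
  ρ-p = ==⇒≡ (∧⁻ˡ (inst rel-root-check))

  ρ-q : ρ q ≡ β
  ρ-q = ==⇒≡ (∧⁻ˡ (∧⁻ʳ {ρ p == α} (inst rel-root-check)))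

  ρ-r : ρ r ≡ γ
  ρ-r = ==⇒≡ (∧⁻ˡ (∧⁻ʳ {ρ q == β} (∧⁻ʳ {ρ p == α} (inst rel-root-check))))

  ρ-ε : ρ ε ≡ ε
  ρ-ε = ==⇒≡ (∧⁻ʳ {ρ r == γ} (∧⁻ʳ {ρ q == β} (∧⁻ʳ {ρ p == α} (inst rel-root-check))))

  ρ-hue : ∀ i c → (ρ c == hue i) ≡ (c == unrel p q r i)
  ρ-hue 0F c = iff⇒≡ (∧⁻ˡ (all-elim (inst rel-hue-check) c))
  ρ-hue 1F c = iff⇒≡ (∧⁻ˡ (∧⁻ʳ {iff (ρ c == α) (c == p)} (all-elim (inst rel-hue-check) c)))
  ρ-hue 2F c = iff⇒≡ (∧⁻ʳ {iff (ρ c == β) (c == q)} (∧⁻ʳ {iff (ρ c == α) (c == p)} (all-elim (inst rel-hue-check) c)))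

  unrel-proper : ∀ i → not (unrel p q r i == ε) ≡ true
  unrel-proper 0F = ∧⁻ˡ (inst rainbow-proper-check)
  unrel-proper 1F = ∧⁻ˡ (∧⁻ʳ {not (p == ε)} (inst rainbow-proper-check))
  unrel-proper 2F = ∧⁻ʳ {not (q == ε)} (∧⁻ʳ {not (p == ε)} (inst rainbow-proper-check))

-- Patterns of tuples with possible coincidences

record IsColouring (κ : A → A → Hue) : Set where
  field
    loop : ∀ x → κ x x ≡ ε
    comm : ∀ x y → κ x y ≡ κ y x
    twin : ∀ {x y} → κ x y ≡ ε → ∀ z → κ x z ≡ κ y z

  agree₁ : ∀ x y z → agree (κ x y) (κ x z) (κ y z) ≡ true
  agree₁ x y z = ⇒-intro λ eq → subst (λ h → (κ x z == h) ≡ true) (twin (==⇒≡ eq) z) (==-refl (κ x z))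

  agree₂ : ∀ x y z → agree (κ x y) (κ z x) (κ z y) ≡ true
  agree₂ x y z rewrite comm z x | comm z y = agree₁ x y z

  agree₃ : ∀ x y z → agree (κ x y) (κ x z) (κ z y) ≡ true
  agree₃ x y z rewrite comm z y = agree₁ x y z

data I : Set where
  i₀ i₁ i₂ i₃ i₄ i₅ : I

select : A → A → A → A → A → A → I → A
select a b c d e x i₀ = a
select a b c d e x i₁ = b
select a b c d e x i₂ = c
select a b c d e x i₃ = d
select a b c d e x i₄ = e
select a b c d e x i₅ = x

-- The hues above the diagonal are listed column by column, so that a further vertex appends its
-- hues at the end. Patterns of four or five vertices are embedded by repeating the last vertex,
-- with `ε` between its copies.
matrix : (ab ac bc ad bd cd ae be ce de ax bx cx dx ex : Hue) → I → I → Hue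
matrix ab ac bc ad bd cd ae be ce de ax bx cx dx ex = select
  (select ε  ab ac ad ae ax)
  (select ab ε  bc bd be bx)
  (select ac bc ε  cd ce cx)
  (select ad bd cd ε  de dx)
  (select ae be ce de ε  ex)
  (select ax bx cx dx ex ε)

module _ where
  open IsColouring

  pullback : ∀ {κ : B → B → Hue} (π : A → B) → IsColouring κ → IsColouring λ x y → κ (π x) (π y)
  pullback π c = record
    { loop = λ x → loop c (π x)
    ; comm = λ x y → comm c (π x) (π y)
    ; twin = λ eq z → twin c eq (π z)
    }

  recolour : ∀ {κ : A → A → Hue} p q r → rainbow p q r ≡ true → IsColouring κ → IsColouring λ x y → rel p q r (κ x y)
  recolour {κ = κ} p q r rb c = record
    { loop = λ x → ≡.trans (cong ρ (loop c x)) ρ-ε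
    ; comm = λ x y → cong ρ (comm c x y)
    ; twin = λ {x} {y} eq z → cong ρ (twin c (==⇒≡
        (≡.trans (≡.sym (ρ-injective (κ x y) ε)) (subst (λ h → (ρ (κ x y) == h) ≡ true) (≡.sym ρ-ε)
          (subst (λ h → (h == ε) ≡ true) (≡.sym eq) refl)))) z)
    }
    where open Rainbow p q r rb

  matrix-complete : ∀ {κ} → IsColouring κ → ∀ i j → κ i j ≡ matrix
    (κ i₀ i₁) (κ i₀ i₂) (κ i₁ i₂) (κ i₀ i₃) (κ i₁ i₃) (κ i₂ i₃) (κ i₀ i₄) (κ i₁ i₄) (κ i₂ i₄) (κ i₃ i₄)
    (κ i₀ i₅) (κ i₁ i₅) (κ i₂ i₅) (κ i₃ i₅) (κ i₄ i₅) i j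
  matrix-complete c i₀ i₀ = loop c i₀
  matrix-complete c i₀ i₁ = refl
  matrix-complete c i₀ i₂ = refl
  matrix-complete c i₀ i₃ = refl
  matrix-complete c i₀ i₄ = refl
  matrix-complete c i₀ i₅ = refl
  matrix-complete c i₁ i₀ = comm c i₁ i₀
  matrix-complete c i₁ i₁ = loop c i₁
  matrix-complete c i₁ i₂ = refl
  matrix-complete c i₁ i₃ = refl
  matrix-complete c i₁ i₄ = refl
  matrix-complete c i₁ i₅ = refl
  matrix-complete c i₂ i₀ = comm c i₂ i₀
  matrix-complete c i₂ i₁ = comm c i₂ i₁
  matrix-complete c i₂ i₂ = loop c i₂
  matrix-complete c i₂ i₃ = refl
  matrix-complete c i₂ i₄ = refl
  matrix-complete c i₂ i₅ = refl
  matrix-complete c i₃ i₀ = comm c i₃ i₀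
  matrix-complete c i₃ i₁ = comm c i₃ i₁
  matrix-complete c i₃ i₂ = comm c i₃ i₂
  matrix-complete c i₃ i₃ = loop c i₃
  matrix-complete c i₃ i₄ = refl
  matrix-complete c i₃ i₅ = refl
  matrix-complete c i₄ i₀ = comm c i₄ i₀
  matrix-complete c i₄ i₁ = comm c i₄ i₁
  matrix-complete c i₄ i₂ = comm c i₄ i₂
  matrix-complete c i₄ i₃ = comm c i₄ i₃
  matrix-complete c i₄ i₄ = loop c i₄
  matrix-complete c i₄ i₅ = refl
  matrix-complete c i₅ i₀ = comm c i₅ i₀
  matrix-complete c i₅ i₁ = comm c i₅ i₁
  matrix-complete c i₅ i₂ = comm c i₅ i₂
  matrix-complete c i₅ i₃ = comm c i₅ i₃
  matrix-complete c i₅ i₄ = comm c i₅ i₄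
  matrix-complete c i₅ i₅ = loop c i₅

misses : Hue → Hue → Hue → Hue → Bool
misses i p q r = not (p == i) ∧ not (q == i) ∧ not (r == i)

-- The certificate for rainbow triangles

data Triple : Set where
  t012 t013 t014 t023 t024 t034 t123 t124 t134 t234 : Triple

on : Triple → (A → A → A → B) → A → A → A → A → A → B
on t012 f a b c d e = f a b c
on t013 f a b c d e = f a b d
on t014 f a b c d e = f a b e
on t023 f a b c d e = f a c d
on t024 f a b c d e = f a c e
on t034 f a b c d e = f a d e
on t123 f a b c d e = f b c d
on t124 f a b c d e = f b c e
on t134 f a b c d e = f b d e
on t234 f a b c d e = f c d e

data Entry : Set where
  at : Triple → Fin 3 → ℕ → Entry

-- The nonnegative multipliers, found by linear programming. A clause lists the canonical form of a
-- 5-vertex pattern a, b, c, d, e with ab, ac, bc coloured α, β, γ; an entry `at t i w` puts weight w on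
-- the assertion that more than a third of all vertices are not dominated in colour i by the triple t.
table : (ad bd cd ae be ce de : Hue) → Maybe (List Entry)
table α α α α α α α = just (at t034 0F 36 ∷ [])
table α α α α α α β = just (at t013 0F 20 ∷ at t013 1F 15 ∷ at t034 0F 15 ∷ [])
table α α α α α α ε = just (at t013 1F 4 ∷ at t023 0F 27 ∷ [])
table α α α α α β α = just (at t013 0F 67 ∷ at t024 1F 8 ∷ at t034 0F 49 ∷ [])
table α α α α α β β = just (at t012 0F 39 ∷ at t013 0F 48 ∷ at t013 2F 16 ∷ at t024 1F 47 ∷
  at t034 0F 54 ∷ at t123 1F 41 ∷ at t123 2F 31 ∷ at t134 0F 40 ∷ at t234 2F 21 ∷ [])
table α α α α α β γ = just (at t012 0F 28 ∷ at t013 0F 125 ∷ at t023 1F 28 ∷ at t024 2F 55 ∷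
  at t034 0F 57 ∷ at t123 1F 39 ∷ at t123 2F 35 ∷ at t134 0F 42 ∷ [])
table α α α α β α α = just (at t013 1F 22 ∷ at t023 0F 29 ∷ at t034 0F 34 ∷ at t034 2F 25 ∷
  at t123 1F 7 ∷ [])
table α α α α β α β = just (at t023 0F 52 ∷ at t034 0F 24 ∷ at t124 1F 20 ∷ at t134 0F 11 ∷
  at t134 1F 35 ∷ at t134 2F 35 ∷ [])
table α α α α β α γ = just (at t012 0F 38 ∷ at t012 1F 32 ∷ at t014 0F 18 ∷ at t014 2F 2 ∷
  at t023 0F 4 ∷ at t023 1F 26 ∷ at t023 2F 27 ∷ at t024 1F 18 ∷ at t024 2F 21 ∷ [])
table α α α α β β α = just (at t034 0F 74 ∷ at t134 0F 44 ∷ [])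
table α α α α β β β = just (at t023 0F 39 ∷ at t024 1F 57 ∷ [])
table α α α α β β γ = just (at t012 0F 49 ∷ at t012 1F 31 ∷ at t013 0F 65 ∷ at t014 1F 23 ∷
  at t023 0F 34 ∷ at t024 1F 3 ∷ at t024 2F 49 ∷ at t034 0F 1 ∷ at t123 2F 12 ∷ at t124 0F 21 ∷
  at t134 0F 76 ∷ at t134 2F 39 ∷ at t234 1F 70 ∷ at t234 2F 15 ∷ [])
table α α α α β γ α = just (at t013 0F 42 ∷ at t014 2F 6 ∷ at t123 1F 18 ∷ at t123 2F 2 ∷
  at t134 0F 34 ∷ [])
table α α α α β γ β = just (at t013 0F 84 ∷ at t023 0F 46 ∷ at t034 1F 33 ∷ at t124 0F 40 ∷
  at t124 1F 42 ∷ at t134 0F 52 ∷ at t134 2F 43 ∷ at t234 1F 13 ∷ [])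
table α α α α γ α α = just (at t023 0F 14 ∷ at t034 0F 84 ∷ at t134 0F 21 ∷ [])
table α α α α γ α β = just (at t012 0F 28 ∷ at t014 1F 14 ∷ at t023 0F 59 ∷ at t024 1F 31 ∷
  at t024 2F 12 ∷ [])
table α α α α γ α γ = just (at t012 0F 17 ∷ at t023 0F 22 ∷ at t034 0F 51 ∷ at t134 2F 11 ∷ [])
table α α α α γ β α = just (at t013 0F 53 ∷ at t034 0F 59 ∷ at t134 0F 32 ∷ [])
table α α α α γ β β = just (at t012 0F 30 ∷ at t012 2F 20 ∷ at t013 0F 27 ∷ at t014 1F 13 ∷
  at t023 0F 40 ∷ at t024 1F 46 ∷ at t024 2F 20 ∷ [])
table α α α α γ β γ = just (at t012 0F 5 ∷ at t013 0F 145 ∷ at t023 0F 25 ∷ at t024 1F 37 ∷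
  at t024 2F 32 ∷ at t034 1F 32 ∷ at t134 0F 19 ∷ at t134 2F 59 ∷ [])
table α α α α γ γ α = just (at t013 0F 100 ∷ at t023 0F 8 ∷ at t023 1F 7 ∷ at t134 0F 14 ∷ [])
table α α α α γ γ β = just (at t012 0F 36 ∷ at t013 0F 74 ∷ at t014 2F 24 ∷ at t023 0F 76 ∷
  at t023 1F 17 ∷ at t024 1F 39 ∷ at t124 2F 19 ∷ [])
table α α α α γ γ γ = just (at t012 0F 45 ∷ at t013 0F 56 ∷ at t024 1F 28 ∷ at t024 2F 29 ∷
  at t034 0F 50 ∷ at t034 1F 32 ∷ at t134 2F 26 ∷ at t234 0F 31 ∷ at t234 1F 26 ∷ [])
table α α α α ε γ α = just (at t013 0F 47 ∷ [])
table α α α β β α α = just (at t014 1F 28 ∷ at t023 0F 67 ∷ at t023 2F 10 ∷ at t034 2F 18 ∷ [])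
table α α α β β α β = just (at t023 0F 46 ∷ at t024 1F 27 ∷ at t024 2F 17 ∷ at t034 1F 43 ∷
  at t124 1F 36 ∷ at t134 0F 53 ∷ at t234 1F 3 ∷ [])
table α α α β β α γ = just (at t012 0F 79 ∷ at t012 1F 24 ∷ at t013 0F 6 ∷ at t014 2F 60 ∷
  at t023 0F 60 ∷ at t024 1F 77 ∷ at t024 2F 32 ∷ at t034 0F 52 ∷ at t034 1F 43 ∷ at t123 0F 44 ∷
  at t124 1F 52 ∷ at t134 0F 62 ∷ at t134 2F 34 ∷ at t234 1F 21 ∷ at t234 2F 64 ∷ [])
table α α α β β β α = just (at t013 0F 41 ∷ at t034 0F 47 ∷ at t123 0F 27 ∷ at t134 0F 29 ∷ [])
table α α α β β β γ = just (at t013 0F 102 ∷ at t014 1F 20 ∷ at t034 0F 30 ∷ at t123 0F 62 ∷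
  at t134 0F 66 ∷ at t134 2F 115 ∷ [])
table α α α β β γ α = just (at t013 0F 68 ∷ at t023 0F 38 ∷ at t134 0F 13 ∷ [])
table α α α β β γ β = just (at t013 0F 88 ∷ at t023 0F 14 ∷ at t024 1F 31 ∷ at t034 1F 66 ∷
  at t123 0F 26 ∷ at t124 2F 57 ∷ at t134 0F 26 ∷ at t234 1F 26 ∷ [])
table α α α β β γ γ = just (at t013 0F 68 ∷ at t014 1F 35 ∷ at t014 2F 59 ∷ at t023 0F 73 ∷
  at t024 1F 87 ∷ at t024 2F 7 ∷ at t034 1F 64 ∷ at t123 1F 27 ∷ at t124 0F 41 ∷ at t234 2F 148 ∷
  [])
table α α α β γ α α = just (at t012 1F 10 ∷ at t013 0F 14 ∷ at t023 0F 29 ∷ at t024 2F 22 ∷ [])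
table α α α β γ α β = just (at t012 0F 37 ∷ at t012 2F 19 ∷ at t013 0F 43 ∷ at t014 1F 43 ∷
  at t023 0F 41 ∷ at t024 1F 7 ∷ at t024 2F 51 ∷ at t034 0F 31 ∷ at t034 1F 2 ∷ at t123 0F 42 ∷
  at t123 2F 57 ∷ at t124 1F 40 ∷ at t124 2F 43 ∷ at t134 0F 45 ∷ at t234 1F 88 ∷ at t234 2F 5 ∷
  [])
table α α α β γ β α = just (at t013 0F 68 ∷ at t023 0F 20 ∷ at t123 0F 28 ∷ [])
table α α α β γ β β = just (at t012 0F 11 ∷ at t013 0F 104 ∷ at t014 1F 28 ∷ at t023 1F 22 ∷
  at t024 1F 18 ∷ at t034 0F 51 ∷ at t034 1F 37 ∷ at t123 0F 25 ∷ at t123 2F 25 ∷ at t124 1F 18 ∷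
  at t134 0F 38 ∷ at t134 2F 67 ∷ at t234 1F 104 ∷ at t234 2F 71 ∷ [])
table α α α β γ β γ = just (at t012 0F 76 ∷ at t013 0F 149 ∷ at t023 1F 73 ∷ at t024 1F 122 ∷
  at t034 0F 58 ∷ at t123 0F 49 ∷ at t123 1F 34 ∷ at t124 2F 71 ∷ at t134 2F 128 ∷ at t234 2F 65 ∷
  [])
table α α α β γ ε α = just (at t023 0F 37 ∷ at t023 2F 7 ∷ [])
table α α α γ β α α = just (at t012 0F 4 ∷ at t012 1F 4 ∷ at t023 0F 8 ∷ at t023 2F 16 ∷ [])
table α α α γ β α β = just (at t012 0F 39 ∷ at t014 2F 29 ∷ at t023 0F 78 ∷ at t024 1F 42 ∷
  at t024 2F 57 ∷ at t034 0F 47 ∷ at t034 1F 29 ∷ at t123 0F 57 ∷ at t123 1F 3 ∷ at t124 1F 54 ∷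
  at t124 2F 8 ∷ at t134 2F 30 ∷ at t234 1F 36 ∷ at t234 2F 23 ∷ [])
table α α α γ β β α = just (at t023 0F 25 ∷ at t034 0F 56 ∷ [])
table α α α γ β β β = just (at t014 1F 45 ∷ at t014 2F 54 ∷ at t024 1F 40 ∷ at t034 0F 24 ∷
  at t123 0F 70 ∷ at t123 1F 69 ∷ at t234 0F 35 ∷ at t234 1F 113 ∷ at t234 2F 52 ∷ [])
table α α α γ β β γ = just (at t012 0F 27 ∷ at t012 1F 26 ∷ at t014 1F 34 ∷ at t023 0F 62 ∷
  at t023 2F 8 ∷ at t024 1F 30 ∷ at t024 2F 57 ∷ at t034 0F 58 ∷ at t123 0F 66 ∷ at t123 1F 17 ∷
  at t124 1F 29 ∷ at t134 0F 47 ∷ at t134 2F 68 ∷ at t234 1F 109 ∷ at t234 2F 56 ∷ [])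
table α α β α α β α = just (at t012 1F 18 ∷ at t012 2F 37 ∷ at t013 0F 34 ∷ at t023 1F 22 ∷ [])
table α α β α α β β = just (at t012 0F 28 ∷ at t012 2F 88 ∷ at t013 0F 72 ∷ at t023 1F 72 ∷
  at t123 1F 43 ∷ at t123 2F 24 ∷ at t134 0F 9 ∷ [])
table α α β α α β γ = just (at t013 0F 30 ∷ at t023 1F 45 ∷ at t023 2F 8 ∷ at t034 0F 11 ∷
  at t034 1F 9 ∷ at t123 1F 10 ∷ at t123 2F 24 ∷ at t134 0F 21 ∷ at t134 1F 33 ∷ at t234 0F 4 ∷
  at t234 1F 6 ∷ [])
table α α β α α β ε = just (at t012 2F 31 ∷ at t013 0F 25 ∷ at t023 1F 16 ∷ at t123 0F 28 ∷
  at t123 1F 49 ∷ at t123 2F 28 ∷ [])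
table α α β α α γ α = just (at t012 1F 16 ∷ at t013 0F 38 ∷ at t023 1F 51 ∷ [])
table α α β α α γ β = just (at t012 0F 13 ∷ at t012 2F 42 ∷ at t013 0F 94 ∷ at t014 2F 40 ∷
  at t023 1F 125 ∷ at t034 0F 38 ∷ at t123 1F 42 ∷ at t123 2F 40 ∷ at t124 1F 47 ∷ at t124 2F 51 ∷
  at t134 0F 67 ∷ at t134 2F 25 ∷ at t234 0F 29 ∷ [])
table α α β α β α α = just (at t012 2F 5 ∷ at t014 0F 30 ∷ at t014 2F 7 ∷ at t024 1F 12 ∷
  at t034 0F 53 ∷ [])
table α α β α β α β = just (at t012 0F 13 ∷ at t013 0F 27 ∷ at t014 0F 39 ∷ at t023 0F 31 ∷
  at t024 1F 30 ∷ at t024 2F 19 ∷ at t034 0F 48 ∷ at t124 1F 52 ∷ at t134 2F 42 ∷ at t234 1F 50 ∷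
  [])
table α α β α β β α = just (at t012 1F 34 ∷ at t012 2F 23 ∷ at t014 0F 19 ∷ at t014 2F 23 ∷
  at t024 1F 56 ∷ at t034 0F 25 ∷ [])
table α α β α β γ α = just (at t012 2F 45 ∷ at t013 0F 3 ∷ at t014 0F 41 ∷ at t023 1F 24 ∷
  at t124 2F 10 ∷ [])
table α α β α β γ β = just (at t012 0F 36 ∷ at t013 0F 53 ∷ at t014 2F 44 ∷ at t023 0F 29 ∷
  at t123 1F 44 ∷ at t124 0F 26 ∷ at t124 2F 77 ∷ at t134 0F 44 ∷ [])
table α α β α γ α α = just (at t014 0F 22 ∷ at t014 2F 40 ∷ at t023 1F 21 ∷ at t024 1F 31 ∷
  at t024 2F 18 ∷ at t034 0F 59 ∷ at t124 2F 3 ∷ [])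
table α α β α γ α γ = just (at t012 0F 61 ∷ at t014 0F 67 ∷ at t024 1F 49 ∷ at t034 0F 82 ∷
  at t034 1F 13 ∷ at t123 2F 4 ∷ at t124 1F 18 ∷ at t124 2F 79 ∷ at t134 2F 42 ∷ at t234 1F 48 ∷
  at t234 2F 26 ∷ [])
table α α β α γ β α = just (at t012 2F 31 ∷ at t013 0F 25 ∷ at t013 2F 3 ∷ at t023 1F 39 ∷
  at t024 0F 8 ∷ at t024 1F 24 ∷ at t024 2F 47 ∷ [])
table α α β α γ β γ = just (at t013 0F 37 ∷ at t014 2F 55 ∷ at t023 0F 72 ∷ at t024 1F 1 ∷
  at t034 1F 91 ∷ at t123 1F 12 ∷ at t124 1F 23 ∷ at t134 0F 26 ∷ [])
table α α β α γ γ α = just (at t012 1F 20 ∷ at t012 2F 34 ∷ at t013 0F 38 ∷ at t014 0F 36 ∷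
  at t023 1F 57 ∷ at t124 2F 37 ∷ [])
table α α β α ε γ α = just (at t012 0F 1 ∷ at t012 1F 25 ∷ at t012 2F 35 ∷ at t013 0F 40 ∷
  at t023 1F 13 ∷ [])
table α α β β α α β = just (at t012 0F 20 ∷ at t014 0F 38 ∷ at t014 2F 16 ∷ at t024 0F 26 ∷
  at t024 1F 39 ∷ at t024 2F 29 ∷ at t124 1F 12 ∷ at t124 2F 3 ∷ [])
table α α β β α γ β = just (at t012 1F 25 ∷ at t013 0F 43 ∷ at t014 2F 36 ∷ at t024 1F 28 ∷
  at t024 2F 12 ∷ at t124 2F 28 ∷ [])
table α α β β β α β = just (at t012 0F 14 ∷ at t014 0F 32 ∷ at t014 1F 8 ∷ at t024 1F 76 ∷
  at t124 1F 12 ∷ at t124 2F 17 ∷ [])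
table α α β β β α γ = just (at t012 0F 71 ∷ at t012 1F 28 ∷ at t014 2F 23 ∷ at t024 1F 42 ∷
  at t123 0F 29 ∷ at t123 2F 31 ∷ at t124 0F 4 ∷ at t124 1F 78 ∷ at t124 2F 37 ∷ [])
table α α β β β γ β = just (at t012 2F 13 ∷ at t013 0F 48 ∷ at t014 1F 24 ∷ at t024 1F 25 ∷
  at t024 2F 16 ∷ at t034 1F 24 ∷ at t124 2F 32 ∷ [])
table α α β β β γ γ = just (at t012 0F 5 ∷ at t012 1F 90 ∷ at t013 0F 40 ∷ at t014 0F 33 ∷
  at t024 1F 14 ∷ at t024 2F 22 ∷ at t123 2F 42 ∷ at t124 0F 29 ∷ at t124 1F 33 ∷ at t124 2F 67 ∷
  [])
table α α β β γ α β = just (at t012 0F 52 ∷ at t012 2F 24 ∷ at t024 1F 47 ∷ at t124 2F 28 ∷ [])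
table α α β β γ α γ = just (at t012 0F 37 ∷ at t012 1F 88 ∷ at t013 0F 30 ∷ at t023 0F 47 ∷
  at t023 1F 1 ∷ at t024 1F 88 ∷ at t024 2F 1 ∷ at t034 0F 45 ∷ at t034 1F 54 ∷ at t234 1F 65 ∷
  [])
table α α β β γ γ β = just (at t012 0F 9 ∷ at t013 0F 60 ∷ at t023 1F 30 ∷ [])
table α α β β γ ε β = just (at t012 0F 16 ∷ at t012 1F 5 ∷ at t012 2F 53 ∷ at t013 0F 34 ∷
  at t023 1F 42 ∷ [])
table α α β γ α α γ = just (at t012 0F 37 ∷ at t014 0F 67 ∷ at t023 2F 38 ∷ at t024 0F 17 ∷
  at t024 1F 26 ∷ at t024 2F 15 ∷ at t034 1F 28 ∷ at t124 2F 8 ∷ [])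
table α α β γ α β γ = just (at t012 2F 29 ∷ at t014 0F 10 ∷ at t014 1F 4 ∷ at t024 0F 7 ∷
  at t024 1F 61 ∷ at t024 2F 8 ∷ [])
table α α β γ α γ γ = just (at t012 1F 22 ∷ at t014 0F 21 ∷ at t014 2F 25 ∷ at t024 2F 63 ∷ [])
table α α β γ β α γ = just (at t012 0F 41 ∷ at t012 2F 25 ∷ at t023 2F 14 ∷ at t024 0F 18 ∷
  at t024 1F 44 ∷ at t124 1F 31 ∷ [])
table α α β γ β β γ = just (at t012 1F 23 ∷ at t012 2F 38 ∷ at t014 1F 11 ∷ at t023 2F 15 ∷
  at t024 0F 10 ∷ at t024 1F 119 ∷ at t034 0F 28 ∷ [])
table α α β γ γ α γ = just (at t012 0F 13 ∷ at t014 0F 26 ∷ at t014 2F 43 ∷ at t023 2F 22 ∷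
  at t024 0F 37 ∷ at t024 1F 24 ∷ at t024 2F 30 ∷ at t034 1F 12 ∷ at t124 2F 31 ∷ [])
table α α β γ γ β γ = just (at t012 1F 5 ∷ at t012 2F 26 ∷ at t014 2F 25 ∷ at t023 0F 26 ∷
  at t024 1F 36 ∷ [])
table α β α α β α γ = just (at t013 0F 40 ∷ at t013 1F 19 ∷ at t023 0F 7 ∷ at t023 1F 1 ∷
  at t123 1F 16 ∷ at t123 2F 8 ∷ [])
table α β α α β α ε = just (at t013 1F 1 ∷ at t023 0F 5 ∷ [])
table α β α α β β α = just (at t012 2F 13 ∷ at t014 1F 12 ∷ at t024 0F 28 ∷ at t034 0F 37 ∷ [])
table α β α α β β γ = just (at t012 0F 35 ∷ at t013 0F 61 ∷ at t014 0F 20 ∷ at t014 1F 36 ∷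
  at t024 2F 53 ∷ at t034 0F 62 ∷ at t123 1F 18 ∷ at t234 1F 27 ∷ [])
table α β α α β γ γ = just (at t012 0F 43 ∷ at t012 1F 43 ∷ at t013 0F 40 ∷ at t034 0F 46 ∷
  at t123 2F 27 ∷ at t124 0F 51 ∷ at t124 2F 38 ∷ at t134 0F 24 ∷ at t234 1F 46 ∷ [])
table α β α α γ α β = just (at t012 0F 43 ∷ at t024 0F 40 ∷ at t024 1F 41 ∷ at t034 0F 56 ∷
  at t034 1F 15 ∷ at t124 1F 33 ∷ at t124 2F 59 ∷ [])
table α β α α γ α γ = just (at t014 0F 24 ∷ at t024 0F 25 ∷ at t034 0F 57 ∷ at t124 2F 32 ∷
  at t134 2F 24 ∷ [])
table α β α α γ β β = just (at t013 0F 94 ∷ at t024 1F 47 ∷ at t034 0F 41 ∷ at t034 1F 17 ∷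
  at t124 0F 19 ∷ at t234 2F 38 ∷ [])
table α β α α γ β γ = just (at t013 0F 86 ∷ at t014 1F 45 ∷ at t014 2F 36 ∷ at t023 1F 29 ∷
  at t024 1F 21 ∷ at t034 0F 46 ∷ at t134 0F 31 ∷ at t134 2F 42 ∷ at t234 2F 5 ∷ [])
table α β α α ε γ β = just (at t012 0F 10 ∷ at t012 1F 17 ∷ at t013 0F 50 ∷ at t013 1F 15 ∷
  at t013 2F 17 ∷ [])
table α β α β α α β = just (at t024 0F 58 ∷ at t034 1F 23 ∷ [])
table α β α β α α γ = just (at t012 0F 60 ∷ at t012 1F 58 ∷ at t014 2F 61 ∷ at t123 0F 41 ∷
  at t123 2F 16 ∷ [])
table α β α β α γ β = just (at t012 2F 30 ∷ at t013 0F 51 ∷ at t014 1F 38 ∷ at t023 0F 22 ∷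
  at t034 0F 32 ∷ at t034 1F 31 ∷ at t123 0F 43 ∷ at t124 1F 40 ∷ at t124 2F 23 ∷ at t134 2F 52 ∷
  at t234 1F 39 ∷ [])
table α β α β α γ γ = just (at t012 0F 27 ∷ at t013 0F 3 ∷ at t014 1F 66 ∷ at t014 2F 27 ∷
  at t123 0F 68 ∷ at t123 2F 23 ∷ at t124 1F 14 ∷ at t124 2F 52 ∷ [])
table α β α β β α γ = just (at t012 0F 77 ∷ at t013 2F 18 ∷ at t014 1F 33 ∷ at t014 2F 50 ∷
  at t034 0F 53 ∷ at t123 0F 57 ∷ at t123 2F 2 ∷ at t134 0F 17 ∷ at t134 2F 18 ∷ [])
table α β α β β γ γ = just (at t012 0F 38 ∷ at t012 1F 42 ∷ at t013 0F 12 ∷ at t014 1F 73 ∷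
  at t023 0F 46 ∷ at t023 2F 50 ∷ at t024 2F 26 ∷ at t034 0F 13 ∷ at t034 1F 50 ∷ at t123 0F 25 ∷
  at t124 2F 63 ∷ at t134 1F 39 ∷ at t234 2F 35 ∷ [])
table α β α β γ α γ = just (at t012 0F 61 ∷ at t012 1F 49 ∷ at t013 2F 38 ∷ at t014 0F 1 ∷
  at t014 1F 38 ∷ at t014 2F 67 ∷ at t023 0F 23 ∷ at t023 1F 25 ∷ at t024 2F 40 ∷ at t034 0F 107 ∷
  at t034 1F 24 ∷ at t123 0F 22 ∷ at t134 0F 15 ∷ at t134 2F 13 ∷ at t234 1F 40 ∷ at t234 2F 24 ∷
  [])
table α β α γ α β γ = just (at t012 1F 25 ∷ at t013 0F 58 ∷ at t023 2F 39 ∷ at t024 0F 55 ∷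
  at t024 2F 36 ∷ at t034 1F 46 ∷ at t123 0F 37 ∷ at t124 1F 62 ∷ at t124 2F 5 ∷ at t134 2F 51 ∷
  [])
table α β β α β β α = just (at t013 0F 31 ∷ at t023 1F 16 ∷ at t034 0F 6 ∷ at t123 2F 25 ∷ [])
table α β β α β β β = just (at t013 2F 14 ∷ at t023 0F 17 ∷ at t123 1F 16 ∷ at t234 1F 24 ∷ [])
table α β β α β β γ = just (at t013 0F 23 ∷ at t013 1F 16 ∷ at t023 1F 14 ∷ at t123 2F 19 ∷
  at t234 1F 6 ∷ [])
table α β β α β β ε = just (at t023 1F 22 ∷ at t123 1F 15 ∷ [])
table α β β α β γ β = just (at t012 0F 44 ∷ at t012 1F 8 ∷ at t012 2F 16 ∷ at t123 1F 38 ∷ [])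
table α β β α β γ γ = just (at t012 1F 2 ∷ at t013 2F 28 ∷ at t014 0F 43 ∷ at t024 2F 14 ∷
  at t134 0F 31 ∷ at t234 1F 67 ∷ [])
table α β β α γ α β = just (at t013 0F 4 ∷ at t023 0F 39 ∷ at t023 1F 19 ∷ at t034 0F 31 ∷
  at t124 2F 25 ∷ at t234 1F 18 ∷ [])
table α β β α γ α γ = just (at t012 1F 8 ∷ at t014 0F 59 ∷ at t024 0F 22 ∷ at t034 0F 54 ∷
  at t123 0F 44 ∷ at t124 2F 23 ∷ at t134 2F 32 ∷ at t234 1F 16 ∷ [])
table α β β α γ β β = just (at t012 2F 30 ∷ at t023 1F 21 ∷ at t034 0F 41 ∷ at t124 1F 59 ∷ [])
table α β β α γ β γ = just (at t023 1F 7 ∷ at t034 0F 48 ∷ at t124 1F 52 ∷ at t124 2F 33 ∷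
  at t134 0F 16 ∷ [])
table α β β α ε γ β = just (at t012 0F 30 ∷ at t012 1F 10 ∷ at t123 1F 20 ∷ [])
table α β β β α α α = just (at t013 1F 46 ∷ at t034 0F 21 ∷ at t134 0F 39 ∷ [])
table α β β β α γ α = just (at t012 1F 30 ∷ at t013 0F 21 ∷ at t013 1F 18 ∷ at t014 0F 38 ∷
  at t014 2F 25 ∷ at t023 1F 21 ∷ at t024 2F 11 ∷ [])
table α β β β α γ β = just (at t013 0F 42 ∷ at t023 1F 30 ∷ at t034 1F 49 ∷ at t124 2F 35 ∷ [])
table α β β β β γ α = just (at t012 1F 38 ∷ at t012 2F 4 ∷ at t013 0F 22 ∷ at t013 1F 34 ∷
  at t014 0F 29 ∷ at t024 2F 21 ∷ [])
table α β β β β γ β = just (at t012 0F 11 ∷ at t034 1F 35 ∷ [])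
table α β β β γ α β = just (at t023 0F 33 ∷ at t023 1F 11 ∷ at t123 0F 23 ∷ at t123 2F 25 ∷
  at t234 1F 22 ∷ [])
table α β β β γ ε β = just (at t023 0F 14 ∷ at t023 1F 34 ∷ [])
table α β β γ α β α = just (at t013 1F 9 ∷ at t023 0F 4 ∷ at t023 1F 36 ∷ [])
table α β β γ α γ α = just (at t023 0F 10 ∷ at t023 1F 35 ∷ at t024 2F 78 ∷ at t034 0F 43 ∷ [])
table α β β γ β α α = just (at t012 2F 4 ∷ at t013 0F 15 ∷ at t034 0F 36 ∷ [])
table α β β ε α β α = just (at t013 0F 10 ∷ at t023 1F 33 ∷ [])
table α β γ α β γ β = just (at t013 1F 4 ∷ [])
table α β γ α β γ ε = just (at t013 1F 15 ∷ at t023 0F 12 ∷ [])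
table α β γ α γ β γ = just (at t012 1F 30 ∷ at t014 0F 27 ∷ at t014 1F 19 ∷ at t014 2F 1 ∷
  at t124 1F 1 ∷ [])
table α β γ β γ α γ = just (at t012 0F 46 ∷ at t012 2F 2 ∷ [])
table α β γ β γ ε γ = just (at t012 0F 24 ∷ at t012 1F 9 ∷ at t012 2F 1 ∷ [])
table α γ β α γ β α = just (at t013 0F 16 ∷ at t013 2F 37 ∷ at t023 0F 32 ∷ at t023 1F 7 ∷
  at t123 1F 31 ∷ at t123 2F 7 ∷ at t134 1F 10 ∷ at t234 2F 4 ∷ [])
table α γ β α γ β ε = just (at t013 0F 21 ∷ at t013 2F 19 ∷ [])
table α γ β α ε γ γ = just (at t012 1F 6 ∷ at t012 2F 23 ∷ at t013 0F 4 ∷ at t013 1F 11 ∷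
  at t023 1F 19 ∷ at t123 2F 8 ∷ [])
table α ε γ α ε γ ε = just (at t012 0F 14 ∷ at t012 1F 7 ∷ [])
table α ε γ β γ ε γ = just ([])
table α ε γ γ β α β = just (at t012 0F 7 ∷ at t012 1F 13 ∷ [])
table _ _ _ _ _ _ _ = nothing

entries : Maybe (List Entry) → List Entry
entries (just es) = es
entries nothing   = []

-- The possible beginnings of a clause of `table`, tested before the fifth and sixth vertices are
-- chosen.
row : Hue → Hue → Hue → Bool
row α α α = true
row α α β = true
row α β α = true
row α β β = true
row α β γ = true
row α γ β = true
row α ε γ = true
row _ _ _ = false

opaque
  unfolding all

  row-check : (all λ ad → all λ bd → all λ cd → all λ ae → all λ be → all λ ce → all λ de →
    not (row ad bd cd) ⇒ not (is-just (table ad bd cd ae be ce de))) ≡ true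
  row-check = refl

no-row⇒nothing : ∀ ad bd cd ae be ce de → row ad bd cd ≡ false → table ad bd cd ae be ce de ≡ nothing
no-row⇒nothing ad bd cd ae be ce de eq = not-just (⇒-elim
  (all-elim (all-elim (all-elim (all-elim (all-elim (all-elim (all-elim row-check ad) bd) cd) ae) be) ce) de)
  (cong not eq))
  where
  not-just : ∀ {m : Maybe (List Entry)} → not (is-just m) ≡ true → m ≡ nothing
  not-just {nothing} _ = refl

-- Evaluating the certificate on six vertices

Valuation : Set
Valuation = List Entry → Hue → Hue → Hue → Hue → Hue → ℕ

score : Valuation
score []              _ _ _ _ _ = 0
score (at t i w ∷ es) p q r s u = (if on t (misses (hue i)) p q r s u then w else 0) + score es p q r s u

weight : List Entry → ℕ
weight []              = 0
weight (at _ _ w ∷ es) = w + weight es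

-- score and weight evaluated in one pass, as the two digits of a number in base K
both : ℕ → Valuation
both K []              _ _ _ _ _ = 0
both K (at t i w ∷ es) p q r s u =
  (if on t (misses (hue i)) p q r s u then w * suc K else w) + both K es p q r s u

both≡ : ∀ K es p q r s u → both K es p q r s u ≡ K * score es p q r s u + weight es
both≡ K []              p q r s u = ≡.sym (≡.trans (+-identityʳ (K * 0)) (*-zeroʳ K))
both≡ K (at t i w ∷ es) p q r s u with on t (misses (hue i)) p q r s u
... | true  = ≡.trans (cong (w * suc K +_) (both≡ K es p q r s u)) (lem K w (score es p q r s u) (weight es))
  where
  lem : ∀ K w s t → w * suc K + (K * s + t) ≡ K * (w + s) + (w + t)
  lem = solve-∀
... | false = ≡.trans (cong (w +_) (both≡ K es p q r s u)) (lem K w (score es p q r s u) (weight es))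
  where
  lem : ∀ K w s t → w + (K * s + t) ≡ K * s + (w + t)
  lem = solve-∀

module _ (val : Valuation) where

  -- The triangle a, b, c is assumed to be renamed already. Leaving `val` abstract lets the
  -- undominated weight, the total weight and their packed form share all invariance lemmas.
  lookup-value : (A → A → Hue) → A → A → A → List A → ℕ
  lookup-value κ a b c (d ∷ e ∷ x ∷ []) =
    val (entries (table (κ a d) (κ b d) (κ c d) (κ a e) (κ b e) (κ c e) (κ d e)))
        (κ a x) (κ b x) (κ c x) (κ d x) (κ e x)
  lookup-value κ a b c _ = 0

  rooted-charge : (A → A → Hue) → A → A → A → List A → ℕ
  rooted-charge κ a b c xs =
    if rainbow (κ a b) (κ a c) (κ b c)
    then lookup-value (λ x y → rel (κ a b) (κ a c) (κ b c) (κ x y)) a b c xs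
    else 0

  charge : (A → A → Hue) → List A → ℕ
  charge κ (a ∷ b ∷ c ∷ xs) = rooted-charge κ a b c xs
  charge κ _                = 0

  -- The sum of charge over all orderings of six vertices, abandoning an ordering as soon as its
  -- first three or four vertices do not match the table.
  row-sum : (ad bd cd : Hue) → (A → A → Hue) → A → A → A → A → List A → ℕ
  row-sum ad bd cd κ a b c d xs =
    if row ad bd cd then permSum 2 (λ ys → lookup-value κ a b c (d ∷ ys)) xs else 0

  root-sum : (p q r : Hue) → (A → A → Hue) → A → A → A → List A → ℕ
  root-sum p q r κ a b c xs =
    if rainbow p q r
    then selectSum (λ d → row-sum (rel p q r (κ a d)) (rel p q r (κ b d)) (rel p q r (κ c d))
                            (λ x y → rel p q r (κ x y)) a b c d) xs
    else 0

  charge-sum : (A → A → Hue) → List A → ℕ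
  charge-sum κ = selectSum λ a → selectSum λ b → selectSum λ c → root-sum (κ a b) (κ a c) (κ b c) κ a b c

  -- Only zero terms are pruned: a triangle that is not rainbow has charge 0, and outside `row` the
  -- table has no clause, which counts as an empty list of entries.
  charge-sum≡ : (∀ p q r s u → val [] p q r s u ≡ 0) → ∀ (κ : A → A → Hue) xs → charge-sum κ xs ≡ permSum 6 (charge κ) xs
  charge-sum≡ {A} val[] κ = selectSum-cong λ a → selectSum-cong λ b → selectSum-cong λ c →
    root (κ a b) (κ a c) (κ b c) a b c
    where
    no-row : ∀ (κ′ : A → A → Hue) a b c d → row (κ′ a d) (κ′ b d) (κ′ c d) ≡ false →
      ∀ ys → lookup-value κ′ a b c (d ∷ ys) ≡ 0
    no-row κ′ a b c d eq (e ∷ x ∷ [])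
      rewrite no-row⇒nothing (κ′ a d) (κ′ b d) (κ′ c d) (κ′ a e) (κ′ b e) (κ′ c e) (κ′ d e) eq = val[] _ _ _ _ _
    no-row κ′ a b c d eq []              = refl
    no-row κ′ a b c d eq (_ ∷ [])        = refl
    no-row κ′ a b c d eq (_ ∷ _ ∷ _ ∷ _) = refl
    row≡ : ∀ (κ′ : A → A → Hue) a b c d xs → row-sum (κ′ a d) (κ′ b d) (κ′ c d) κ′ a b c d xs ≡
      permSum 2 (λ ys → lookup-value κ′ a b c (d ∷ ys)) xs
    row≡ κ′ a b c d xs with row (κ′ a d) (κ′ b d) (κ′ c d) in eq
    ... | true  = refl
    ... | false = ≡.sym (≡.trans (permSum-cong 2 (no-row κ′ a b c d eq) xs) (permSum-zero 2 xs))
    root : ∀ p q r a b c xs → root-sum p q r κ a b c xs ≡ permSum 3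
      (λ ys → if rainbow p q r then lookup-value (λ x y → rel p q r (κ x y)) a b c ys else 0) xs
    root p q r a b c xs with rainbow p q r
    ... | true  = selectSum-cong (row≡ (λ x y → rel p q r (κ x y)) a b c) xs
    ... | false = ≡.sym (permSum-zero 3 xs)

  lookup-value-cong : ∀ {κ κ′ : A → A → Hue} → (∀ x y → κ x y ≡ κ′ x y) →
    ∀ a b c xs → lookup-value κ a b c xs ≡ lookup-value κ′ a b c xs
  lookup-value-cong eq a b c (d ∷ e ∷ x ∷ [])
    rewrite eq a d | eq b d | eq c d | eq a e | eq b e | eq c e | eq d e
          | eq a x | eq b x | eq c x | eq d x | eq e x = refl
  lookup-value-cong eq a b c []                  = refl
  lookup-value-cong eq a b c (_ ∷ [])            = refl
  lookup-value-cong eq a b c (_ ∷ _ ∷ [])        = refl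
  lookup-value-cong eq a b c (_ ∷ _ ∷ _ ∷ _ ∷ _) = refl

  charge-cong : ∀ {κ κ′ : A → A → Hue} → (∀ x y → κ x y ≡ κ′ x y) → ∀ xs → charge κ xs ≡ charge κ′ xs
  charge-cong {κ = κ} {κ′} eq (a ∷ b ∷ c ∷ xs) rewrite eq a b | eq a c | eq b c =
    cong (if rainbow (κ′ a b) (κ′ a c) (κ′ b c) then_else 0)
         (lookup-value-cong (λ x y → cong (rel (κ′ a b) (κ′ a c) (κ′ b c)) (eq x y)) a b c xs)
  charge-cong eq []           = refl
  charge-cong eq (_ ∷ [])     = refl
  charge-cong eq (_ ∷ _ ∷ []) = refl

  lookup-value-map : ∀ (π : A → B) (κ : B → B → Hue) a b c xs →
    lookup-value κ (π a) (π b) (π c) (map π xs) ≡ lookup-value (λ x y → κ (π x) (π y)) a b c xs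
  lookup-value-map π κ a b c []                  = refl
  lookup-value-map π κ a b c (_ ∷ [])            = refl
  lookup-value-map π κ a b c (_ ∷ _ ∷ [])        = refl
  lookup-value-map π κ a b c (_ ∷ _ ∷ _ ∷ [])    = refl
  lookup-value-map π κ a b c (_ ∷ _ ∷ _ ∷ _ ∷ _) = refl

  charge-map : ∀ (π : A → B) (κ : B → B → Hue) xs → charge κ (map π xs) ≡ charge (λ x y → κ (π x) (π y)) xs
  charge-map π κ []               = refl
  charge-map π κ (_ ∷ [])         = refl
  charge-map π κ (_ ∷ _ ∷ [])     = refl
  charge-map π κ (a ∷ b ∷ c ∷ xs) = cong (if rainbow (κ (π a) (π b)) (κ (π a) (π c)) (κ (π b) (π c)) then_else 0)
    (lookup-value-map π (λ x y → rel (κ (π a) (π b)) (κ (π a) (π c)) (κ (π b) (π c)) (κ x y)) a b c xs)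

  -- The charge renames colours after its own leading triangle, and this absorbs a renaming made
  -- beforehand.
  charge-rel : ∀ {p q r} → rainbow p q r ≡ true → ∀ (κ : A → A → Hue) xs →
    charge (λ x y → rel p q r (κ x y)) xs ≡ charge κ xs
  charge-rel rb κ []           = refl
  charge-rel rb κ (_ ∷ [])     = refl
  charge-rel rb κ (_ ∷ _ ∷ []) = refl
  charge-rel {p = p} {q} {r} rb κ (a ∷ b ∷ c ∷ xs) = cong₂ (if_then_else 0) (rainbow-ρ (κ a b) (κ a c) (κ b c))
    (lookup-value-cong (λ x y → rel-ρ (κ a b) (κ a c) (κ b c) (κ x y)) a b c xs)
    where open Rainbow p q r rb

-- Canonical orderings and the finite checks

root-first : (A → A → Hue) → List A → Bool
root-first κ (a ∷ b ∷ c ∷ xs) = rainbow (κ a b) (κ a c) (κ b c)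
root-first κ _                = false

canonical : (A → A → Hue) → List A → Bool
canonical κ (a ∷ b ∷ c ∷ d ∷ e ∷ []) = rainbow (κ a b) (κ a c) (κ b c) ∧
  (let ρ = rel (κ a b) (κ a c) (κ b c) in
   is-just (table (ρ (κ a d)) (ρ (κ b d)) (ρ (κ c d)) (ρ (κ a e)) (ρ (κ b e)) (ρ (κ c e)) (ρ (κ d e))))
canonical κ _ = false

canonical-cong : ∀ {κ κ′ : A → A → Hue} → (∀ x y → κ x y ≡ κ′ x y) → ∀ xs → canonical κ xs ≡ canonical κ′ xs
canonical-cong eq (a ∷ b ∷ c ∷ d ∷ e ∷ [])
  rewrite eq a b | eq a c | eq b c | eq a d | eq b d | eq c d | eq a e | eq b e | eq c e | eq d e = refl
canonical-cong eq []                          = refl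
canonical-cong eq (_ ∷ [])                    = refl
canonical-cong eq (_ ∷ _ ∷ [])                = refl
canonical-cong eq (_ ∷ _ ∷ _ ∷ [])            = refl
canonical-cong eq (_ ∷ _ ∷ _ ∷ _ ∷ [])        = refl
canonical-cong eq (_ ∷ _ ∷ _ ∷ _ ∷ _ ∷ _ ∷ _) = refl

canonical-map : ∀ (π : A → B) (κ : B → B → Hue) xs → canonical κ (map π xs) ≡ canonical (λ x y → κ (π x) (π y)) xs
canonical-map π κ (_ ∷ _ ∷ _ ∷ _ ∷ _ ∷ [])    = refl
canonical-map π κ []                          = refl
canonical-map π κ (_ ∷ [])                    = refl
canonical-map π κ (_ ∷ _ ∷ [])                = refl
canonical-map π κ (_ ∷ _ ∷ _ ∷ [])            = refl
canonical-map π κ (_ ∷ _ ∷ _ ∷ _ ∷ [])        = refl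
canonical-map π κ (_ ∷ _ ∷ _ ∷ _ ∷ _ ∷ _ ∷ _) = refl

canonical-rel : ∀ {p q r} → rainbow p q r ≡ true → ∀ (κ : A → A → Hue) xs →
  canonical (λ x y → rel p q r (κ x y)) xs ≡ canonical κ xs
canonical-rel {p = p} {q} {r} rb κ (a ∷ b ∷ c ∷ d ∷ e ∷ [])
  rewrite Rainbow.rainbow-ρ p q r rb (κ a b) (κ a c) (κ b c)
        | Rainbow.rel-ρ p q r rb (κ a b) (κ a c) (κ b c) (κ a d) | Rainbow.rel-ρ p q r rb (κ a b) (κ a c) (κ b c) (κ b d) | Rainbow.rel-ρ p q r rb (κ a b) (κ a c) (κ b c) (κ c d)
        | Rainbow.rel-ρ p q r rb (κ a b) (κ a c) (κ b c) (κ a e) | Rainbow.rel-ρ p q r rb (κ a b) (κ a c) (κ b c) (κ b e) | Rainbow.rel-ρ p q r rb (κ a b) (κ a c) (κ b c) (κ c e) | Rainbow.rel-ρ p q r rb (κ a b) (κ a c) (κ b c) (κ d e) = refl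
canonical-rel rb κ []                          = refl
canonical-rel rb κ (_ ∷ [])                    = refl
canonical-rel rb κ (_ ∷ _ ∷ [])                = refl
canonical-rel rb κ (_ ∷ _ ∷ _ ∷ [])            = refl
canonical-rel rb κ (_ ∷ _ ∷ _ ∷ _ ∷ [])        = refl
canonical-rel rb κ (_ ∷ _ ∷ _ ∷ _ ∷ _ ∷ _ ∷ _) = refl

-- With `link-consistent` and `triangle-consistent`, this distributes the coincidence conditions
-- over the triangles that meet the root a, b, c in two, one and no vertices. Each test can then be
-- applied as soon as its hues are fixed.
root-consistent : (ad bd cd : Hue) → Bool
root-consistent ad bd cd =
  agree ad α bd ∧ agree ad β cd ∧ agree bd α ad ∧ agree bd γ cd ∧ agree cd β ad ∧ agree cd γ bd

link-consistent : (ad bd cd ae be ce de : Hue) → Bool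
link-consistent ad bd cd ae be ce de =
  agree ad ae de ∧ agree bd be de ∧ agree cd ce de ∧
  agree ae ad de ∧ agree be bd de ∧ agree ce cd de ∧
  agree de ad ae ∧ agree de bd be ∧ agree de cd ce

triangle-consistent : (de dx ex : Hue) → Bool
triangle-consistent de dx ex = agree de dx ex ∧ agree dx de ex ∧ agree ex de dx

module RootedColouring {κ : A → A → Hue} (col : IsColouring κ) {a b c : A}
  (ab : κ a b ≡ α) (ac : κ a c ≡ β) (bc : κ b c ≡ γ) where

  open IsColouring col

  private
    replace : ∀ {u v v′ w} → v ≡ v′ → agree u v w ≡ true → agree u v′ w ≡ true
    replace refl eq = eq

  root-ok : ∀ d → root-consistent (κ a d) (κ b d) (κ c d) ≡ true
  root-ok d =
    replace ab (agree₃ a d b) ∧⁺ replace ac (agree₃ a d c) ∧⁺ replace ab (agree₂ b d a) ∧⁺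
    replace bc (agree₃ b d c) ∧⁺ replace ac (agree₂ c d a) ∧⁺ replace bc (agree₂ c d b)

  link-ok : ∀ d e → link-consistent (κ a d) (κ b d) (κ c d) (κ a e) (κ b e) (κ c e) (κ d e) ≡ true
  link-ok d e =
    agree₁ a d e ∧⁺ agree₁ b d e ∧⁺ agree₁ c d e ∧⁺ agree₃ a e d ∧⁺ agree₃ b e d ∧⁺ agree₃ c e d ∧⁺
    agree₂ d e a ∧⁺ agree₂ d e b ∧⁺ agree₂ d e c

  triangle-ok : ∀ d e x → triangle-consistent (κ d e) (κ d x) (κ e x) ≡ true
  triangle-ok d e x = agree₁ d e x ∧⁺ agree₃ d x e ∧⁺ agree₂ e x d

opaque
  unfolding all

  -- Every five-vertex pattern containing a rainbow triangle can be reordered into a clause of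
  -- `table`, so only extensions of clauses remain to be examined. For this reason the pattern a, b,
  -- c, b, c has a clause although its list of entries is empty.
  canonical-check : (all λ ad → all λ bd → all λ cd → root-consistent ad bd cd ⇒
    (all λ ae → all λ be → all λ ce → root-consistent ae be ce ⇒
    (all λ de → link-consistent ad bd cd ae be ce de ⇒
    permAny 5 (canonical (matrix α β γ ad bd cd ae be ce de ae be ce de ε)) (i₀ ∷ i₁ ∷ i₂ ∷ i₃ ∷ i₄ ∷ [])))) ≡ true
  canonical-check = refl

-- Any base is sound; this one exceeds every total weight that occurs, so that the check succeeds.
base : ℕ
base = 1000000

nonpositive : (K : ℕ) .{{_ : NonZero K}} → ℕ → Bool
nonpositive K v = 3 * (v / K) ≤ᵇ v % K

indices : List I
indices = i₀ ∷ i₁ ∷ i₂ ∷ i₃ ∷ i₄ ∷ i₅ ∷ []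

opaque
  unfolding all

  -- The clause only selects a representative ordering of the pattern. The sum runs over all
  -- orderings of the six vertices, since any five of them may match a clause, in several ways, and
  -- leave the remaining one as the vertex to be dominated.
  nonpositive-check : (all λ ad → all λ bd → all λ cd → all λ ae → all λ be → all λ ce → all λ de →
    is-just (table ad bd cd ae be ce de) ⇒
    (all λ ax → all λ bx → all λ cx → root-consistent ax bx cx ⇒
    (all λ dx → link-consistent ad bd cd ax bx cx dx ⇒
    (all λ ex → link-consistent ae be ce ax bx cx ex ⇒ triangle-consistent de dx ex ⇒
    nonpositive base (charge-sum (both base) (matrix α β γ ad bd cd ae be ce de ax bx cx dx ex) indices))))) ≡ true
  nonpositive-check = refl

-- A carry out of the lower digit can only raise the quotient above a and push the remainder below
-- b. Overflow thus makes the test harder to pass, never unsound.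
digits : ∀ K a b .{{_ : NonZero K}} → nonpositive K (K * a + b) ≡ true → 3 * a ≤ b
digits K a b eq = begin
  3 * a                    ≡⟨ cong (3 *_) (≡.trans (≡.sym (m*n/n≡m a K)) (cong (_/ K) (*-comm a K))) ⟩
  3 * (K * a / K)          ≤⟨ *-monoʳ-≤ 3 (/-monoˡ-≤ K (m≤m+n (K * a) b)) ⟩
  3 * ((K * a + b) / K)    ≤⟨ ≤ᵇ⇒≤ _ _ (subst T (≡.sym eq) tt) ⟩
  (K * a + b) % K          ≡⟨ cong (_% K) (≡.trans (+-comm (K * a) b) (cong (b +_) (*-comm K a))) ⟩
  (b + a * K) % K          ≡⟨ [m+kn]%n≡m%n b a K ⟩
  b % K                    ≤⟨ m%n≤m b K ⟩
  b                        ∎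
  where open ≤-Reasoning

weight′ : Valuation
weight′ es _ _ _ _ _ = weight es

charge-both : ∀ K (κ : A → A → Hue) xs → charge (both K) κ xs ≡ K * charge score κ xs + charge weight′ κ xs
charge-both K κ []               = ≡.sym (≡.trans (+-identityʳ (K * 0)) (*-zeroʳ K))
charge-both K κ (_ ∷ [])         = ≡.sym (≡.trans (+-identityʳ (K * 0)) (*-zeroʳ K))
charge-both K κ (_ ∷ _ ∷ [])     = ≡.sym (≡.trans (+-identityʳ (K * 0)) (*-zeroʳ K))
charge-both K κ (a ∷ b ∷ c ∷ xs) with rainbow (κ a b) (κ a c) (κ b c)
... | false = ≡.sym (≡.trans (+-identityʳ (K * 0)) (*-zeroʳ K))
... | true  = go xs
  where
  ρ = λ x y → rel (κ a b) (κ a c) (κ b c) (κ x y)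
  go : ∀ xs → lookup-value (both K) ρ a b c xs ≡ K * lookup-value score ρ a b c xs + lookup-value weight′ ρ a b c xs
  go (d ∷ e ∷ x ∷ [])    = both≡ K (entries (table (ρ a d) (ρ b d) (ρ c d) (ρ a e) (ρ b e) (ρ c e) (ρ d e))) _ _ _ _ _
  go []                  = ≡.sym (≡.trans (+-identityʳ (K * 0)) (*-zeroʳ K))
  go (_ ∷ [])            = ≡.sym (≡.trans (+-identityʳ (K * 0)) (*-zeroʳ K))
  go (_ ∷ _ ∷ [])        = ≡.sym (≡.trans (+-identityʳ (K * 0)) (*-zeroʳ K))
  go (_ ∷ _ ∷ _ ∷ _ ∷ _) = ≡.sym (≡.trans (+-identityʳ (K * 0)) (*-zeroʳ K))

-- From checked patterns to arbitrary colourings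

record Bounded (κ : A → A → Hue) (xs : List A) : Set where
  constructor bounded-by
  field bound : 3 * permSum 6 (charge score κ) xs ≤ permSum 6 (charge weight′ κ) xs

nonpositive⇒Bounded : ∀ K .{{_ : NonZero K}} {κ : A → A → Hue} {xs} →
  nonpositive K (charge-sum (both K) κ xs) ≡ true → Bounded κ xs
nonpositive⇒Bounded K {κ} {xs} eq = bounded-by (digits K (permSum 6 (charge score κ) xs) (permSum 6 (charge weight′ κ) xs)
  (subst (λ v → nonpositive K v ≡ true) (begin
    charge-sum (both K) κ xs
      ≡⟨ charge-sum≡ (both K) (λ _ _ _ _ _ → refl) κ xs ⟩
    permSum 6 (charge (both K) κ) xs
      ≡⟨ permSum-cong 6 (charge-both K κ) xs ⟩
    permSum 6 (λ ys → K * charge score κ ys + charge weight′ κ ys) xs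
      ≡⟨ permSum-linear 6 K (charge score κ) (charge weight′ κ) xs ⟩
    K * permSum 6 (charge score κ) xs + permSum 6 (charge weight′ κ) xs ∎) eq))
  where open ≡-Reasoning

Bounded-transport : ∀ {κ : A → A → Hue} {κ′ : B → B → Hue} {xs ys} →
  (∀ val → permSum 6 (charge val κ) xs ≡ permSum 6 (charge val κ′) ys) → Bounded κ′ ys → Bounded κ xs
Bounded-transport eq (bounded-by le) =
  bounded-by (subst₂ (λ s t → 3 * s ≤ t) (≡.sym (eq score)) (≡.sym (eq weight′)) le)

Bounded-↭ : ∀ {κ : A → A → Hue} {xs ys} → xs ↭ ys → Bounded κ xs → Bounded κ ys
Bounded-↭ {κ = κ} p = Bounded-transport λ val → permSum-↭ 6 (charge val κ) (↭-sym p)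

module Pattern (ad bd cd ae be ce : Hue) where

  canonical-reordering : ∀ de → root-consistent ad bd cd ≡ true → root-consistent ae be ce ≡ true →
    link-consistent ad bd cd ae be ce de ≡ true →
    ∃[ ys ] (ys ↭ i₀ ∷ i₁ ∷ i₂ ∷ i₃ ∷ i₄ ∷ [] ×
             canonical (matrix α β γ ad bd cd ae be ce de ae be ce de ε) ys ≡ true)
  canonical-reordering de rd re l =
    permAny-true 5 (canonical (matrix α β γ ad bd cd ae be ce de ae be ce de ε)) (i₀ ∷ i₁ ∷ i₂ ∷ i₃ ∷ i₄ ∷ []) refl
      (⇒-elim (all-elim (⇒-elim (all-elim (all-elim (all-elim
        (⇒-elim (all-elim (all-elim (all-elim canonical-check ad) bd) cd) rd) ae) be) ce) re) de) l)

  canonical-bounded : ∀ de ax bx cx dx ex → is-just (table ad bd cd ae be ce de) ≡ true →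
    root-consistent ax bx cx ≡ true → link-consistent ad bd cd ax bx cx dx ≡ true →
    link-consistent ae be ce ax bx cx ex ≡ true → triangle-consistent de dx ex ≡ true →
    Bounded (matrix α β γ ad bd cd ae be ce de ax bx cx dx ex) indices
  canonical-bounded de ax bx cx dx ex key rx ld le t = nonpositive⇒Bounded base
    (⇒-elim (⇒-elim (all-elim (⇒-elim (all-elim (⇒-elim (all-elim (all-elim (all-elim
      (⇒-elim (all-elim (all-elim (all-elim (all-elim (all-elim (all-elim (all-elim nonpositive-check
        ad) bd) cd) ae) be) ce) de) key) ax) bx) cx) rx) dx) ld) ex) le) t)

module _ {A : Set} {κ : A → A → Hue} (col : IsColouring κ) {a b c : A}
  (rb : rainbow (κ a b) (κ a c) (κ b c) ≡ true) where

  open Rainbow (κ a b) (κ a c) (κ b c) rb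

  private
    κ₁ : A → A → Hue
    κ₁ y z = ρ (κ y z)

    col₁ : IsColouring κ₁
    col₁ = recolour (κ a b) (κ a c) (κ b c) rb col

    matrix-κ₁ : ∀ d e x i j → let π = select a b c d e x in κ₁ (π i) (π j) ≡ matrix α β γ
      (κ₁ a d) (κ₁ b d) (κ₁ c d) (κ₁ a e) (κ₁ b e) (κ₁ c e) (κ₁ d e)
      (κ₁ a x) (κ₁ b x) (κ₁ c x) (κ₁ d x) (κ₁ e x) i j
    -- The constants `α`, `β`, `γ` are turned back into the renamed hues of ab, ac, bc, which gives
    -- the form that `matrix-complete` produces.
    matrix-κ₁ d e x i j rewrite ≡.sym ρ-p | ≡.sym ρ-q | ≡.sym ρ-r =
      matrix-complete (pullback (select a b c d e x) col₁) i j

    normalise : ∀ (π : I → A) {xs} → xs ≡ map π indices →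
      ∀ {M : I → I → Hue} → (∀ i j → κ₁ (π i) (π j) ≡ M i j) → ∀ val →
      permSum 6 (charge val κ) xs ≡ permSum 6 (charge val M) indices
    normalise π {xs} eq {M} M-correct val = begin
      permSum 6 (charge val κ) xs                                ≡⟨ cong (permSum 6 (charge val κ)) eq ⟩
      permSum 6 (charge val κ) (map π indices)                   ≡⟨ permSum-map 6 π (charge val κ) indices ⟩
      permSum 6 (charge val κ ∘ map π) indices                   ≡⟨ permSum-cong 6 (charge-map val π κ) indices ⟩
      permSum 6 (charge val λ i j → κ (π i) (π j)) indices
        ≡⟨ permSum-cong 6 (charge-rel val rb λ i j → κ (π i) (π j)) indices ⟨
      permSum 6 (charge val λ i j → κ₁ (π i) (π j)) indices      ≡⟨ permSum-cong 6 (charge-cong val M-correct) indices ⟩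
      permSum 6 (charge val M) indices                           ∎
      where open ≡-Reasoning

  open RootedColouring col₁ ρ-p ρ-q ρ-r

  canonical⇒Bounded : ∀ d e x → canonical κ (a ∷ b ∷ c ∷ d ∷ e ∷ []) ≡ true →
    Bounded κ (a ∷ b ∷ c ∷ d ∷ e ∷ x ∷ [])
  canonical⇒Bounded d e x can = Bounded-transport
    (normalise (select a b c d e x) refl (matrix-κ₁ d e x))
    (Pattern.canonical-bounded (κ₁ a d) (κ₁ b d) (κ₁ c d) (κ₁ a e) (κ₁ b e) (κ₁ c e) (κ₁ d e)
      (κ₁ a x) (κ₁ b x) (κ₁ c x) (κ₁ d x) (κ₁ e x)
      (∧⁻ʳ {rainbow (κ a b) (κ a c) (κ b c)} can) (root-ok x) (link-ok d x) (link-ok e x) (triangle-ok d e x))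

  reorder : ∀ d e → ∃[ ys ] (ys ↭ a ∷ b ∷ c ∷ d ∷ e ∷ [] × canonical κ ys ≡ true)
  reorder d e = pull (Pattern.canonical-reordering
    (κ₁ a d) (κ₁ b d) (κ₁ c d) (κ₁ a e) (κ₁ b e) (κ₁ c e) (κ₁ d e) (root-ok d) (root-ok e) (link-ok d e))
    where
    open ≡-Reasoning
    -- The sixth index is a second copy of e, which makes the five-vertex pattern an instance of the
    -- six-vertex matrix.
    π = select a b c d e e
    M-correct : ∀ i j → κ₁ (π i) (π j) ≡ matrix α β γ
      (κ₁ a d) (κ₁ b d) (κ₁ c d) (κ₁ a e) (κ₁ b e) (κ₁ c e) (κ₁ d e)
      (κ₁ a e) (κ₁ b e) (κ₁ c e) (κ₁ d e) ε i j
    M-correct i j = ≡.trans (matrix-κ₁ d e e i j)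
      (cong (λ h → matrix α β γ (κ₁ a d) (κ₁ b d) (κ₁ c d) (κ₁ a e) (κ₁ b e) (κ₁ c e) (κ₁ d e)
        (κ₁ a e) (κ₁ b e) (κ₁ c e) (κ₁ d e) h i j) (IsColouring.loop col₁ e))
    pull : ∃[ zs ] (zs ↭ i₀ ∷ i₁ ∷ i₂ ∷ i₃ ∷ i₄ ∷ [] × canonical (matrix α β γ
             (κ₁ a d) (κ₁ b d) (κ₁ c d) (κ₁ a e) (κ₁ b e) (κ₁ c e) (κ₁ d e)
             (κ₁ a e) (κ₁ b e) (κ₁ c e) (κ₁ d e) ε) zs ≡ true) →
           ∃[ ys ] (ys ↭ a ∷ b ∷ c ∷ d ∷ e ∷ [] × canonical κ ys ≡ true)
    pull (zs , zs↭ , can) = map π zs , map⁺ π zs↭ , (begin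
      canonical κ (map π zs)                    ≡⟨ canonical-map π κ zs ⟩
      canonical (λ i j → κ (π i) (π j)) zs      ≡⟨ canonical-rel rb (λ i j → κ (π i) (π j)) zs ⟨
      canonical (λ i j → κ₁ (π i) (π j)) zs     ≡⟨ ≡.trans (canonical-cong M-correct zs) can ⟩
      true                                      ∎)

module _ {A : Set} {κ : A → A → Hue} (col : IsColouring κ) where

  -- The bound does not depend on the order of the vertices. If no ordering begins with a rainbow
  -- triangle, the left side is 0. Otherwise such an ordering is taken, and its first five vertices
  -- are rearranged into a clause while the sixth stays last.
  bounded : ∀ xs → length xs ≡ 6 → Bounded κ xs
  bounded xs len with permAny 6 (root-first κ) xs in eq
  ... | false = bounded-by (subst (λ s → 3 * s ≤ permSum 6 (charge weight′ κ) xs)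
                  (≡.sym (permAny-false 6 (root-first κ) {charge score κ} no-root xs eq)) z≤n)
    where
    no-root : ∀ ys → root-first κ ys ≡ false → charge score κ ys ≡ 0
    no-root []               _   = refl
    no-root (_ ∷ [])         _   = refl
    no-root (_ ∷ _ ∷ [])     _   = refl
    no-root (a ∷ b ∷ c ∷ ys) eq′ rewrite eq′ = refl
  ... | true  = from-root (permAny-true 6 (root-first κ) xs len eq)
    where
    from-canonical : ∀ {ys} x → ys ∷ʳ x ↭ xs → canonical κ ys ≡ true → Bounded κ xs
    from-canonical {a ∷ b ∷ c ∷ d ∷ e ∷ []} x p can = Bounded-↭ p (canonical⇒Bounded col (∧⁻ˡ can) d e x can)
    from-canonical {[]}                          x p ()
    from-canonical {_ ∷ []}                      x p ()
    from-canonical {_ ∷ _ ∷ []}                  x p ()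
    from-canonical {_ ∷ _ ∷ _ ∷ []}              x p ()
    from-canonical {_ ∷ _ ∷ _ ∷ _ ∷ []}          x p ()
    from-canonical {_ ∷ _ ∷ _ ∷ _ ∷ _ ∷ _ ∷ _} x p ()
    from-reordering : ∀ {ys} x → ys ∷ʳ x ↭ xs → ∃[ zs ] (zs ↭ ys × canonical κ zs ≡ true) → Bounded κ xs
    from-reordering x p (zs , q , can) = from-canonical {zs} x (↭.trans (++⁺ʳ (x ∷ []) q) p) can
    from-root : ∃[ ys ] (ys ↭ xs × root-first κ ys ≡ true) → Bounded κ xs
    from-root (ys , p , rb) = go ys (≡.trans (↭-length p) len) p rb
      where
      go : ∀ ys → length ys ≡ 6 → ys ↭ xs → root-first κ ys ≡ true → Bounded κ xs
      go (a ∷ b ∷ c ∷ d ∷ e ∷ x ∷ []) _ p rb = from-reordering x p (reorder col rb d e)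

-- The certificate for colourings without rainbow triangles

-- The case b = c is allowed, so that every edge gives a cherry.
cherry : Hue → Hue → Hue → Bool
cherry ab ac bc = not (ab == ε) ∧ (ac == ab) ∧ not (bc == ab)

cherry-charge : (Hue → Hue → Hue → Hue → ℕ) → (A → A → Hue) → List A → ℕ
cherry-charge val κ (a ∷ b ∷ c ∷ x ∷ []) =
  if cherry (κ a b) (κ a c) (κ b c) then val (κ a b) (κ a x) (κ b x) (κ c x) else 0
cherry-charge val κ _ = 0

cherry-score cherry-weight : Hue → Hue → Hue → Hue → ℕ
cherry-score  i p q r = if misses i p q r then 1 else 0
cherry-weight i p q r = 1

cherry-charge-cong : ∀ val {κ κ′ : A → A → Hue} → (∀ x y → κ x y ≡ κ′ x y) →
  ∀ xs → cherry-charge val κ xs ≡ cherry-charge val κ′ xs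
cherry-charge-cong val eq (a ∷ b ∷ c ∷ x ∷ [])
  rewrite eq a b | eq a c | eq b c | eq a x | eq b x | eq c x = refl
cherry-charge-cong val eq []                      = refl
cherry-charge-cong val eq (_ ∷ [])                = refl
cherry-charge-cong val eq (_ ∷ _ ∷ [])            = refl
cherry-charge-cong val eq (_ ∷ _ ∷ _ ∷ [])        = refl
cherry-charge-cong val eq (_ ∷ _ ∷ _ ∷ _ ∷ _ ∷ _) = refl

cherry-charge-map : ∀ val (π : A → B) (κ : B → B → Hue) xs →
  cherry-charge val κ (map π xs) ≡ cherry-charge val (λ x y → κ (π x) (π y)) xs
cherry-charge-map val π κ (_ ∷ _ ∷ _ ∷ _ ∷ [])    = refl
cherry-charge-map val π κ []                      = refl
cherry-charge-map val π κ (_ ∷ [])                = refl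
cherry-charge-map val π κ (_ ∷ _ ∷ [])            = refl
cherry-charge-map val π κ (_ ∷ _ ∷ _ ∷ [])        = refl
cherry-charge-map val π κ (_ ∷ _ ∷ _ ∷ _ ∷ _ ∷ _) = refl

opaque
  unfolding all

  -- The twelve `agree` premises are the three coincidence conditions in each of the four triangles.
  -- They are followed by the absence of a rainbow among these triangles.
  cherry-check : (all λ ab → all λ ac → all λ bc → all λ ax → all λ bx → all λ cx →
    agree ab ac bc ∧ agree ab ax bx ∧ agree ac ab bc ∧ agree ac ax cx ∧
    agree bc ab ac ∧ agree bc bx cx ∧ agree ax ab bx ∧ agree ax ac cx ∧
    agree bx ab ax ∧ agree bx bc cx ∧ agree cx ac ax ∧ agree cx bc bx ∧
    not (rainbow ab ac bc) ∧ not (rainbow ab ax bx) ∧ not (rainbow ac ax cx) ∧ not (rainbow bc bx cx) ⇒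
    (let M = matrix ab ac bc ax bx cx ax bx cx ε ax bx cx ε ε ; is = i₀ ∷ i₁ ∷ i₂ ∷ i₃ ∷ [] in
     3 * permSum 4 (cherry-charge cherry-score M) is ≤ᵇ permSum 4 (cherry-charge cherry-weight M) is)) ≡ true
  cherry-check = refl

cherry-bounded : ∀ {κ : A → A → Hue} → IsColouring κ →
  (∀ a b c → rainbow (κ a b) (κ a c) (κ b c) ≡ false) → ∀ xs → length xs ≡ 4 →
  3 * permSum 4 (cherry-charge cherry-score κ) xs ≤ permSum 4 (cherry-charge cherry-weight κ) xs
cherry-bounded {κ = κ} col no-rainbow (a ∷ b ∷ c ∷ x ∷ []) refl =
  subst₂ (λ s t → 3 * s ≤ t) (≡.sym (normalise cherry-score)) (≡.sym (normalise cherry-weight))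
    (≤ᵇ⇒≤ _ _ (subst T (≡.sym (⇒-elim
      (all-elim (all-elim (all-elim (all-elim (all-elim (all-elim cherry-check
        (κ a b)) (κ a c)) (κ b c)) (κ a x)) (κ b x)) (κ c x))
      (agree₁ a b c ∧⁺ agree₁ a b x ∧⁺ agree₃ a c b ∧⁺ agree₁ a c x ∧⁺ agree₂ b c a ∧⁺ agree₁ b c x ∧⁺
       agree₃ a x b ∧⁺ agree₃ a x c ∧⁺ agree₂ b x a ∧⁺ agree₃ b x c ∧⁺ agree₂ c x a ∧⁺ agree₂ c x b ∧⁺
       cong not (no-rainbow a b c) ∧⁺ cong not (no-rainbow a b x) ∧⁺
       cong not (no-rainbow a c x) ∧⁺ cong not (no-rainbow b c x)))) tt))
  where
  open IsColouring col
  π = select a b c x x x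
  M = matrix (κ a b) (κ a c) (κ b c) (κ a x) (κ b x) (κ c x) (κ a x) (κ b x) (κ c x) ε
             (κ a x) (κ b x) (κ c x) ε ε
  M-correct : ∀ i j → κ (π i) (π j) ≡ M i j
  M-correct i j = ≡.trans (matrix-complete (pullback π col) i j)
    (cong (λ h → matrix (κ a b) (κ a c) (κ b c) (κ a x) (κ b x) (κ c x) (κ a x) (κ b x) (κ c x) h
                        (κ a x) (κ b x) (κ c x) h h i j) (loop x))
  normalise : ∀ val → permSum 4 (cherry-charge val κ) (a ∷ b ∷ c ∷ x ∷ []) ≡
    permSum 4 (cherry-charge val M) (i₀ ∷ i₁ ∷ i₂ ∷ i₃ ∷ [])
  normalise val = ≡.trans (permSum-map 4 π (cherry-charge val κ) (i₀ ∷ i₁ ∷ i₂ ∷ i₃ ∷ []))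
    (≡.trans (permSum-cong 4 (cherry-charge-map val π κ) (i₀ ∷ i₁ ∷ i₂ ∷ i₃ ∷ []))
             (permSum-cong 4 (cherry-charge-cong val M-correct) (i₀ ∷ i₁ ∷ i₂ ∷ i₃ ∷ [])))

-- Small sets dominating few vertices

hue≢ε : ∀ i → hue i ≢ ε
hue≢ε 0F ()
hue≢ε 1F ()
hue≢ε 2F ()

hue-injective : ∀ {i j} → hue i ≡ hue j → i ≡ j
hue-injective {0F} {0F} _ = refl
hue-injective {1F} {1F} _ = refl
hue-injective {2F} {2F} _ = refl
hue-injective {0F} {1F} ()
hue-injective {0F} {2F} ()
hue-injective {1F} {2F} ()

hue-surjective : ∀ {h} → not (h == ε) ≡ true → ∃[ i ] h ≡ hue i
hue-surjective {α} _ = 0F , refl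
hue-surjective {β} _ = 1F , refl
hue-surjective {γ} _ = 2F , refl

hueOf : EdgeColouring n 3 → Fin n → Fin n → Hue
hueOf χ x y with x ≟ y
... | yes _ = ε
... | no  _ = hue (colour χ x y)

hueOf-ε : ∀ (χ : EdgeColouring n 3) {x y} → hueOf χ x y ≡ ε → x ≡ y
hueOf-ε χ {x} {y} eq with x ≟ y
... | yes x≡y = x≡y
... | no  _   = ⊥-elim (hue≢ε _ eq)

hueOf-hue : ∀ (χ : EdgeColouring n 3) {x y i} → hueOf χ x y ≡ hue i → x ≢ y × colour χ x y ≡ i
hueOf-hue χ {x} {y} {i} eq with x ≟ y
... | yes _   = ⊥-elim (hue≢ε i (≡.sym eq))
... | no  x≢y = x≢y , hue-injective eq

hueOf-isColouring : (χ : EdgeColouring n 3) → IsColouring (hueOf χ)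
hueOf-isColouring χ = record
  { loop = loop′
  ; comm = comm′
  ; twin = λ {x} {y} eq z → cong (λ v → hueOf χ v z) (hueOf-ε χ {x} {y} eq)
  }
  where
  loop′ : ∀ x → hueOf χ x x ≡ ε
  loop′ x with x ≟ x
  ... | yes _   = refl
  ... | no  x≢x = ⊥-elim (x≢x refl)
  comm′ : ∀ x y → hueOf χ x y ≡ hueOf χ y x
  comm′ x y with x ≟ y | y ≟ x
  ... | yes _   | yes _   = refl
  ... | no  _   | no  _   = cong hue (EdgeColouring.sym χ x y)
  ... | yes x≡y | no  y≢x = ⊥-elim (y≢x (≡.sym x≡y))
  ... | no  x≢y | yes y≡x = ⊥-elim (x≢y (≡.sym y≡x))

superset-of-size : ∀ m (p : Subset n) → ∣ p ∣ ≤ m → m ≤ n → ∃[ q ] (p ⊆ q × ∣ q ∣ ≡ m)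
superset-of-size zero    []            _  _  = [] , (λ x∈ → x∈) , refl
superset-of-size (suc m) (inside ∷ p)  (s≤s le) (s≤s m≤n) with superset-of-size m p le m≤n
... | q , p⊆q , eq = inside ∷ q , s⊆s p⊆q , cong suc eq
superset-of-size {suc n} m (outside ∷ p) le m≤1+n with m ≤? n
... | yes m≤n with superset-of-size m p le m≤n
...   | q , p⊆q , eq = outside ∷ q , s⊆s p⊆q , eq
-- Here m can only be `suc n`, so the full set is the one choice.
superset-of-size {suc n} m (outside ∷ p) le m≤1+n | no m≰n =
  ⊤ , ⊆⊤ , ≡.trans (∣⊤∣≡n (suc n)) (≤-antisym (≰⇒> m≰n) m≤1+n)

∣p∪q∣≤∣p∣+∣q∣ : (p q : Subset n) → ∣ p ∪ q ∣ ≤ ∣ p ∣ + ∣ q ∣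
∣p∪q∣≤∣p∣+∣q∣ []            []            = z≤n
∣p∪q∣≤∣p∣+∣q∣ (outside ∷ p) (outside ∷ q) = ∣p∪q∣≤∣p∣+∣q∣ p q
∣p∪q∣≤∣p∣+∣q∣ (outside ∷ p) (inside ∷ q)  = ≤-trans (s≤s (∣p∪q∣≤∣p∣+∣q∣ p q)) (≤-reflexive (≡.sym (+-suc ∣ p ∣ ∣ q ∣)))
∣p∪q∣≤∣p∣+∣q∣ (inside ∷ p)  (outside ∷ q) = s≤s (∣p∪q∣≤∣p∣+∣q∣ p q)
∣p∪q∣≤∣p∣+∣q∣ (inside ∷ p)  (inside ∷ q)  = s≤s (≤-trans (∣p∪q∣≤∣p∣+∣q∣ p q) (+-monoʳ-≤ ∣ p ∣ (n≤1+n ∣ q ∣)))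

-- When the vertices coincide, their union has fewer than three elements and must be padded; this
-- uses 3 ≤ n.
triple⊆ : 3 ≤ n → (a b c : Fin n) → ∃[ p ] (∣ p ∣ ≡ 3 × a ∈ p × b ∈ p × c ∈ p)
triple⊆ 3≤n a b c with superset-of-size 3 (⁅ a ⁆ ∪ (⁅ b ⁆ ∪ ⁅ c ⁆)) le 3≤n
  where
  le : ∣ ⁅ a ⁆ ∪ (⁅ b ⁆ ∪ ⁅ c ⁆) ∣ ≤ 3
  le = ≤-trans (∣p∪q∣≤∣p∣+∣q∣ ⁅ a ⁆ (⁅ b ⁆ ∪ ⁅ c ⁆))
    (+-mono-≤ (≤-reflexive (∣⁅x⁆∣≡1 a)) (≤-trans (∣p∪q∣≤∣p∣+∣q∣ ⁅ b ⁆ ⁅ c ⁆)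
      (+-mono-≤ (≤-reflexive (∣⁅x⁆∣≡1 b)) (≤-reflexive (∣⁅x⁆∣≡1 c)))))
... | p , sub , eq = p , eq
  , sub (p⊆p∪q (⁅ b ⁆ ∪ ⁅ c ⁆) (x∈⁅x⁆ a))
  , sub (q⊆p∪q ⁅ a ⁆ (⁅ b ⁆ ∪ ⁅ c ⁆) (p⊆p∪q ⁅ c ⁆ (x∈⁅x⁆ b)))
  , sub (q⊆p∪q ⁅ a ⁆ (⁅ b ⁆ ∪ ⁅ c ⁆) (q⊆p∪q ⁅ b ⁆ ⁅ c ⁆ (x∈⁅x⁆ c)))

n≤sum+∣tabulate∣ : (f : Fin n → Bool) (g : Fin n → ℕ) → (∀ x → f x ≡ false → 1 ≤ g x) →
  n ≤ sum g + ∣ tabulate f ∣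
n≤sum+∣tabulate∣ {zero}  f g le = z≤n
n≤sum+∣tabulate∣ {suc n} f g le with f zero in eq | n≤sum+∣tabulate∣ (f ∘ suc) (g ∘ suc) (le ∘ suc)
... | true  | ih = ≤-trans (s≤s (≤-trans ih (+-monoˡ-≤ _ (m≤n+m _ (g zero))))) (≤-reflexive (≡.sym (+-suc _ _)))
... | false | ih = ≤-trans (+-mono-≤ (le zero eq) ih) (≤-reflexive (≡.sym (+-assoc (g zero) _ _)))

distinct-pair : 3 ≤ n → ∃[ u ] ∃[ v ] (_≢_ {A = Fin n} u v)
distinct-pair (s≤s (s≤s _)) = zero , suc zero , λ ()

-- The contradiction from a counterexample

module Counterexample (χ : EdgeColouring n 3) (3≤n : 3 ≤ n)
  (few : ∀ c A → ∣ A ∣ ≡ 3 → 3 * ∣ strongDom χ c A ∣ < 2 * n) where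

  κ : Fin n → Fin n → Hue
  κ = hueOf χ

  col : IsColouring κ
  col = hueOf-isColouring χ

  missed : Hue → Fin n → Fin n → Fin n → ℕ
  missed h a b c = sum λ x → if misses h (κ a x) (κ b x) (κ c x) then 1 else 0

  -- A three-element set p containing a, b, c dominates fewer than 2n/3 vertices. The rest, more
  -- than n/3 of them, are missed by all of p and in particular by a, b and c.
  many-missed : ∀ i a b c → n < 3 * missed (hue i) a b c
  many-missed i a b c with triple⊆ 3≤n a b c
  ... | p , ∣p∣≡3 , a∈p , b∈p , c∈p = +-cancelʳ-< (2 * n) n (3 * u) (begin-strict
    n + 2 * n        ≤⟨ *-monoʳ-≤ 3 (n≤sum+∣tabulate∣ (λ x → ⌊ stronglyDominated? χ i p x ⌋) _ undominated) ⟩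
    3 * (u + D)      ≡⟨ *-distribˡ-+ 3 u D ⟩
    3 * u + 3 * D    <⟨ +-monoʳ-< (3 * u) (few i p ∣p∣≡3) ⟩
    3 * u + 2 * n    ∎)
    where
    open ≤-Reasoning
    u = missed (hue i) a b c
    D = ∣ strongDom χ i p ∣
    other : ∀ {x y} → ¬ StronglyDominated χ i p x → y ∈ p → not (κ y x == hue i) ≡ true
    other {x} {y} ¬dom y∈p with κ y x == hue i in eq
    ... | false = refl
    ... | true with hueOf-hue χ (==⇒≡ eq)
    ...   | y≢x , eq′ = ⊥-elim (¬dom (y , y∈p , y≢x , eq′))
    undominated : ∀ x → ⌊ stronglyDominated? χ i p x ⌋ ≡ false →
      1 ≤ (if misses (hue i) (κ a x) (κ b x) (κ c x) then 1 else 0)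
    undominated x eq with stronglyDominated? χ i p x
    ... | no ¬dom = ≤-reflexive (cong (if_then 1 else 0)
      (≡.sym (other ¬dom a∈p ∧⁺ other ¬dom b∈p ∧⁺ other ¬dom c∈p)))

  -- All five-tuples must have weight 0, whereas a rainbow triangle makes a, b, c, b, b match the
  -- clause `α ε γ α ε γ ε`, whose weight is 14 + 7.
  no-rainbow : ∀ a b c → rainbow (κ a b) (κ a c) (κ b c) ≡ false
  no-rainbow a b c with rainbow (κ a b) (κ a c) (κ b c) in rb
  ... | false = refl
  ... | true  = contradiction (≡.trans (≡.sym W≡) (weights-vanish 5 (charge score κ) (charge weight′ κ) W
                  (λ xs len → Bounded.bound (bounded col xs len)) last≤ (a ∷ b ∷ c ∷ b ∷ b ∷ []) refl)) λ ()
    where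
    W : List (Fin n) → ℕ
    -- The sixth vertex is a dummy, as `weight′` does not look at it.
    W (a ∷ b ∷ c ∷ d ∷ e ∷ []) = charge weight′ κ (a ∷ b ∷ c ∷ d ∷ e ∷ a ∷ [])
    W _                        = 0

    module _ (a b c : Fin n) (rb : rainbow (κ a b) (κ a c) (κ b c) ≡ true) where
      open Rainbow (κ a b) (κ a c) (κ b c) rb

      misses-ρ : ∀ i {j} → unrel (κ a b) (κ a c) (κ b c) i ≡ hue j → ∀ u v w →
        misses (hue i) (ρ u) (ρ v) (ρ w) ≡ misses (hue j) u v w
      misses-ρ i eq u v w rewrite ρ-hue i u | ρ-hue i v | ρ-hue i w | eq = refl

      on-missed : ∀ t i d e → n < 3 * sum λ x →
        if on t (misses (hue i)) (ρ (κ a x)) (ρ (κ b x)) (ρ (κ c x)) (ρ (κ d x)) (ρ (κ e x)) then 1 else 0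
      -- An entry names its colour relative to the rainbow triangle; j is the actual colour of the
      -- edges of `χ` behind it.
      on-missed t i d e with hue-surjective (unrel-proper i)
      ... | j , eq = case t
        where
        step : ∀ u v w → n < 3 * sum λ x → if misses (hue i) (ρ (κ u x)) (ρ (κ v x)) (ρ (κ w x)) then 1 else 0
        step u v w = subst (λ s → n < 3 * s)
          (sum-cong-≗ λ x → cong (if_then 1 else 0) (≡.sym (misses-ρ i eq (κ u x) (κ v x) (κ w x))))
          (many-missed j u v w)
        case : ∀ t → n < 3 * sum λ x →
          if on t (misses (hue i)) (ρ (κ a x)) (ρ (κ b x)) (ρ (κ c x)) (ρ (κ d x)) (ρ (κ e x)) then 1 else 0
        case t012 = step a b c
        case t013 = step a b d
        case t014 = step a b e
        case t023 = step a c d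
        case t024 = step a c e
        case t034 = step a d e
        case t123 = step b c d
        case t124 = step b c e
        case t134 = step b d e
        case t234 = step c d e

      -- Each unit of weight yields n + 1 instead of n, by strictness of `many-missed`. The
      -- additional `weight es` is the term that `weights-vanish` forces to be 0.
      score≥ : ∀ d e es → weight es + n * weight es ≤ 3 * sum λ x →
        score es (ρ (κ a x)) (ρ (κ b x)) (ρ (κ c x)) (ρ (κ d x)) (ρ (κ e x))
      score≥ d e []              = subst (_≤ 3 * sum {n} λ _ → 0) (≡.sym (*-zeroʳ n)) z≤n
      score≥ d e (at t i w ∷ es) = begin
        (w + weight es) + n * (w + weight es)             ≡⟨ expand w (weight es) n ⟩
        w * suc n + (weight es + n * weight es)           ≤⟨ +-mono-≤ (*-monoʳ-≤ w (on-missed t i d e)) (score≥ d e es) ⟩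
        w * (3 * sum u) + 3 * sum s                       ≡⟨ collect w (sum u) (sum s) ⟩
        3 * (w * sum u + sum s)                           ≡⟨ cong (λ v → 3 * (v + sum s)) (*-distribˡ-sum w u) ⟩
        3 * ((sum λ x → w * u x) + sum s)                 ≡⟨ cong (3 *_) (∑-distrib-+ (λ x → w * u x) s) ⟨
        3 * (sum λ x → w * u x + s x)                     ≡⟨ cong (3 *_) (sum-cong-≗ λ x → cong (_+ s x) (scale (m x))) ⟩
        3 * (sum λ x → (if m x then w else 0) + s x)      ∎
        where
        open ≤-Reasoning
        m : Fin n → Bool
        m x = on t (misses (hue i)) (ρ (κ a x)) (ρ (κ b x)) (ρ (κ c x)) (ρ (κ d x)) (ρ (κ e x))
        u s : Fin n → ℕ
        u x = if m x then 1 else 0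
        s x = score es (ρ (κ a x)) (ρ (κ b x)) (ρ (κ c x)) (ρ (κ d x)) (ρ (κ e x))
        scale : ∀ t → w * (if t then 1 else 0) ≡ (if t then w else 0)
        scale true  = *-identityʳ w
        scale false = *-zeroʳ w
        expand : ∀ w t n → (w + t) + n * (w + t) ≡ w * suc n + (t + n * t)
        expand = solve-∀
        collect : ∀ w u s → w * (3 * u) + 3 * s ≡ 3 * (w * u + s)
        collect = solve-∀

    last≤ : ∀ xs → length xs ≡ 5 →
      W xs + (sum λ x → charge weight′ κ (xs ∷ʳ x)) ≤ 3 * sum λ x → charge score κ (xs ∷ʳ x)
    last≤ (a ∷ b ∷ c ∷ d ∷ e ∷ []) refl with rainbow (κ a b) (κ a c) (κ b c) in rb
    ... | false = subst (λ s → s ≤ 3 * sum {n} λ _ → 0) (≡.sym (≡.trans (sum-const n 0) (*-zeroʳ n))) z≤n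
    ... | true  = subst (λ s → weight es + s ≤ 3 * sum λ x →
                    score es (ρ (κ a x)) (ρ (κ b x)) (ρ (κ c x)) (ρ (κ d x)) (ρ (κ e x)))
                    (≡.sym (sum-const n (weight es))) (score≥ a b c rb d e es)
      where
      open Rainbow (κ a b) (κ a c) (κ b c) rb
      es = entries (table (ρ (κ a d)) (ρ (κ b d)) (ρ (κ c d)) (ρ (κ a e)) (ρ (κ b e)) (ρ (κ c e)) (ρ (κ d e)))

    open Rainbow (κ a b) (κ a c) (κ b c) rb
    W≡ : W (a ∷ b ∷ c ∷ b ∷ b ∷ []) ≡ weight (entries (table α ε γ α ε γ ε))
    W≡ rewrite rb | IsColouring.comm col c b | IsColouring.loop col b | ρ-p | ρ-r | ρ-ε = refl

  -- Once rainbow triangles are excluded, the second certificate leaves no cherry at all, yet two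
  -- distinct vertices u, v form the degenerate cherry u, v, v.
  impossible : ⊥
  impossible = contradiction (≡.trans (≡.sym W≡) (weights-vanish 3 (cherry-charge cherry-score κ)
    (cherry-charge cherry-weight κ) W (cherry-bounded col no-rainbow) last≤ (u ∷ v ∷ v ∷ []) refl)) λ ()
    where
    W : List (Fin n) → ℕ
    W (a ∷ b ∷ c ∷ []) = if cherry (κ a b) (κ a c) (κ b c) then 1 else 0
    W _                = 0

    last≤ : ∀ xs → length xs ≡ 3 →
      W xs + (sum λ x → cherry-charge cherry-weight κ (xs ∷ʳ x)) ≤ 3 * sum λ x → cherry-charge cherry-score κ (xs ∷ʳ x)
    last≤ (a ∷ b ∷ c ∷ []) refl with cherry (κ a b) (κ a c) (κ b c) in ch
    ... | false = subst (λ s → s ≤ 3 * sum {n} λ _ → 0) (≡.sym (≡.trans (sum-const n 0) (*-zeroʳ n))) z≤n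
    ... | true with hue-surjective {κ a b} (∧⁻ˡ ch)
    ...   | i , eq rewrite eq =
      -- The left side is `suc n`: 1 from `W` and 1 for each of the n choices of the fourth vertex.
      subst (_≤ 3 * missed (hue i) a b c) (cong suc (≡.sym (≡.trans (sum-const n 1) (*-identityʳ n))))
        (many-missed i a b c)

    u v : Fin n
    u = proj₁ (distinct-pair 3≤n)
    v = proj₁ (proj₂ (distinct-pair 3≤n))

    W≡ : W (u ∷ v ∷ v ∷ []) ≡ 1
    W≡ rewrite IsColouring.loop col v with κ u v in eq
    ... | α = refl
    ... | β = refl
    ... | γ = refl
    ... | ε = ⊥-elim (proj₂ (proj₂ (distinct-pair 3≤n)) (hueOf-ε χ eq))

theorem1p3 : (n : ℕ) → 3 ≤ n → (χ : EdgeColouring n 3) →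
    ∃[ c ] ∃[ A ] (∣ A ∣ ≡ 3 × 2 * n ≤ 3 * ∣ strongDom χ c A ∣)
-- Colours and vertex sets are finite, so the claim is decidable and an argument by contradiction
-- yields an actual witness.
theorem1p3 n 3≤n χ with any? (λ c → anySubset? (λ A → (∣ A ∣ ℕ.≟ 3) ×-dec (2 * n ≤? 3 * ∣ strongDom χ c A ∣)))
... | yes found = found
... | no  none  = ⊥-elim (Counterexample.impossible χ 3≤n λ c A ∣A∣≡3 → ≰⇒> λ le → none (c , A , ∣A∣≡3 , le))
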